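{- For every Halin graph $G$ it holds that $\mathrm{ch}'(G)=\Delta(G)$, where $\Delta(G)$ is the maximum degree of $G$.
   Context: A Halin graph is obtained by taking a planar embedding of a tree $T$ with at least four vertices and with no vertices of degree $2$, and adding a cycle through all leaves of $T$ in the cyclic order in which they appear in the embedding. Given a list assignment $L$ assigning to each edge $e$ a set $L(e)\subset\mathbb{N}$, an $L$-edge-colouring is a map $\mathcal{C}$ on $E(G)$ with $\mathcal{C}(e)\in L(e)$ and with edges sharing an endpoint receiving different colours. $G$ is $k$-edge-choosable if an $L$-edge-colouring exists for every $L$ with all $|L(e)|\ge k$; $\mathrm{ch}'(G)$ is the smallest such $k$. -}

module Defs where

open import Data.Bool.Base using (Bool; T)
open import Data.Fin.Base using (Fin; _<_)
open import Data.Fin.Subset using (Subset; ∣_∣)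
open import Data.List.Base using (List; []; _∷_; _∷ʳ_; map; allFin)
open import Data.List.Extrema.Nat using (max)
open import Data.List.Relation.Unary.Linked using (Linked)
open import Data.List.Relation.Unary.Unique.Propositional using (Unique)
open import Data.Nat.Base using (ℕ; _≤_)
open import Data.Product.Base using (∃-syntax; _×_)
open import Data.Sum.Base using (_⊎_)
open import Data.Vec.Base using (tabulate)
open import Function.Bundles using (_⇔_)
open import Function.Definitions using (Injective)
open import Function.Endo.Propositional using (_^_)
open import Level using (0ℓ)
open import Relation.Binary.Construct.Closure.ReflexiveTransitive using (Star)
open import Relation.Binary.PropositionalEquality.Core using (_≡_; _≢_)
open import Relation.Nullary.Negation.Core using (¬_)
open import Relation.Unary using (Pred; _∈_)

private
  variable
    n : ℕ

-- Finite simple graphs.  Adjacency is Bool-valued so that it is decidable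
-- and has at most one proof for each pair of vertices.

record Graph (n : ℕ) : Set where
  field
    adj     : Fin n → Fin n → Bool
    sym     : ∀ u v → T (adj u v) → T (adj v u)
    irrefl  : ∀ v → ¬ T (adj v v)

  Adj : Fin n → Fin n → Set
  Adj u v = T (adj u v)

  neighbours : Fin n → Subset n
  neighbours v = tabulate (adj v)

  degree : Fin n → ℕ
  degree v = ∣ neighbours v ∣

  maxDegree : ℕ
  maxDegree = max 0 (map degree (allFin n))

  -- An undirected edge is represented once, by its smaller endpoint
  -- followed by its larger one.

  record Edge : Set where
    constructor edge
    field
      source   : Fin n
      target   : Fin n
      ordered  : source < target
      adjacent : Adj source target

  _∈ᵉ_ : Fin n → Edge → Set
  v ∈ᵉ e = v ≡ Edge.source e ⊎ v ≡ Edge.target e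

  ShareEndpoint : Edge → Edge → Set
  ShareEndpoint e f = ∃[ v ] v ∈ᵉ e × v ∈ᵉ f

  Connected : Set
  Connected = ∀ u v → Star Adj u v

  -- The vertices u, v, w, xs are the successive vertices of a cycle, which
  -- therefore has length at least three.

  Acyclic : Set
  Acyclic = ∀ u v w (xs : List (Fin n)) →
            Unique (u ∷ v ∷ w ∷ xs) →
            ¬ Linked Adj ((u ∷ v ∷ w ∷ xs) ∷ʳ u)

  IsTree : Set
  IsTree = Connected × Acyclic

  Leaf : Fin n → Set
  Leaf v = degree v ≡ 1

open Graph using (Adj; degree; maxDegree; Edge; ShareEndpoint; IsTree; Leaf)

-- An embedding in the oriented plane is given combinatorially by its
-- rotation system: next v u is the neighbour of v that follows u in the
-- cyclic order around v.  The field cyclic says that next v permutes the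
-- neighbours of v in a single cycle.  The value of next v u is irrelevant
-- when u is not a neighbour of v.  For a tree every rotation system has
-- exactly one face, hence genus 0, so no planarity condition is needed.

record Rotation (G : Graph n) : Set where
  field
    next   : Fin n → Fin n → Fin n
    closed : ∀ v u → Adj G v u → Adj G v (next v u)
    cyclic : ∀ v u w → Adj G v u → Adj G v w →
             ∃[ k ] (_^_ (Fin n) (next v) k) u ≡ w

module _ (G : Graph n) (ρ : Rotation G) where
  open Rotation ρ

  -- FirstLeaf u v ℓ: the walk along the boundary of the face, starting
  -- with the directed edge from u to v, has ℓ as the first leaf it enters.
  -- After entering v from u, this walk leaves v towards next v u.

  data FirstLeaf (u v : Fin n) : Fin n → Set where
    here : Leaf G v → FirstLeaf u v v
    turn : ∀ {ℓ} → ¬ Leaf G v → FirstLeaf v (next v u) ℓ → FirstLeaf u v ℓ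

  -- ℓ′ follows ℓ in the cyclic order in which the leaves of the embedded
  -- tree appear.

  NextLeaf : Fin n → Fin n → Set
  NextLeaf ℓ ℓ′ = Leaf G ℓ × ∃[ p ] Adj G ℓ p × FirstLeaf ℓ p ℓ′

record IsHalin {n : ℕ} (G : Graph n) : Set where
  field
    tree         : Graph n
    isTree       : IsTree tree
    fourVertices : 4 ≤ n
    noDegreeTwo  : ∀ v → degree tree v ≢ 2
    embedding    : Rotation tree
    adjacency    : ∀ u v → Adj G u v ⇔
                   (Adj tree u v ⊎
                    NextLeaf tree embedding u v ⊎
                    NextLeaf tree embedding v u)

-- |A| ≥ k, for an arbitrary, possibly infinite, set A of naturals.

HasAtLeast : ℕ → Pred ℕ 0ℓ → Set
HasAtLeast k A = ∃[ f ] Injective {A = Fin k} _≡_ _≡_ f × (∀ i → f i ∈ A)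

ListAssignment : Graph n → Set₁
ListAssignment G = Edge G → Pred ℕ 0ℓ

record ListEdgeColouring (G : Graph n) (L : ListAssignment G) : Set where
  field
    colour   : Edge G → ℕ
    fromList : ∀ e → colour e ∈ L e
    proper   : ∀ e f → e ≢ f → ShareEndpoint G e f → colour e ≢ colour f

EdgeChoosable : Graph n → ℕ → Set₁
EdgeChoosable G k = (L : ListAssignment G) → (∀ e → HasAtLeast k (L e)) →
                    ListEdgeColouring G L

-- ch′(G) = k, with ch′ as a relation: the minimum is not computed here.

ListChromaticIndex : Graph n → ℕ → Set₁
ListChromaticIndex G k = EdgeChoosable G k ×
                         (∀ j → EdgeChoosable G j → k ≤ j)

{-# OPTIONS --safe #-}
module Submission where

-- Lower bound: give every edge the palette {0, …, j − 1} and look at the edges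
-- at one vertex.
--
-- Upper bound: root the tree at a leaf z.  The part of the graph beyond a tree
-- edge is joined to the rest by three edges only: the rim edge entering its
-- first leaf, the tree edge itself and the rim edge leaving its last leaf, with
-- colours l, e and r.
--
-- If Δ ≥ 4, colouring greedily shows that for l ≠ e at most two values of r do
-- not extend.  To close up at z, choose z such that the leaf before it hangs
-- from the same vertex; then two nonadjacent edges next to the last rim edge
-- can be coloured so that together they block only one of its colours.
--
-- If Δ = 3, the greedy argument is one colour short.  Instead, the triples that
-- extend contain the nonvanishing set of a polynomial c V + q in l, e, r, where
-- c ≠ 0, V is the Vandermonde polynomial and deg q ≤ 2.  This form is preserved
-- when two branches are joined at a vertex: the product of the two polynomials
-- and of V, of degree 9, is summed over the palettes of the three new inner
-- edges with the weights of second divided differences, each of which lowers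
-- the degree by two.  Closing up at z multiplies by V, and the three divided
-- differences of V² are nonzero.

open import Defs
open import Data.Bool.Base using (Bool; true; false; T)
open import Data.Bool.Properties using (T?; T-irrelevant)
open import Data.Fin.Base using (Fin; zero; suc; toℕ; fromℕ<)
open import Data.Fin.Patterns using (0F; 1F; 2F)
import Data.Fin.Properties as Fin
open import Data.Fin.Subset using (∣_∣)
open import Data.Integer.Base as ℤ using (+_; 0ℤ)
import Data.Integer.Properties as ℤ
open import Data.List.Base using (List; []; _∷_; _++_; _∷ʳ_; map; concatMap; length; lookup; allFin)
import Data.List.Properties as List
open import Data.List.Extrema.Nat using (xs≤max; max≤v⁺)
open import Data.List.Membership.Propositional using (_∈_; _∉_)
open import Data.List.Membership.Propositional.Properties using (∈-++⁺ˡ; ∈-++⁺ʳ; ∈-++⁻)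
open import Data.List.Membership.Propositional.Properties using (∈-map⁺; ∈-map⁻; ∈-allFin; ∈-lookup)
import Data.List.Membership.DecPropositional as DecMembership
open import Data.List.Relation.Binary.Pointwise.Base using (Pointwise; []; _∷_)
open import Data.List.Relation.Unary.All as All using (All; []; _∷_)
import Data.List.Relation.Unary.All.Properties as All
open import Data.List.Relation.Unary.Any as Any using (here; there)
import Data.List.Relation.Unary.Any.Properties as Any
open import Data.List.Relation.Unary.AllPairs using ([]; _∷_)
open import Data.List.Relation.Unary.Linked using (Linked; [-]; _∷_)
open import Data.List.Relation.Unary.Unique.Propositional using (Unique)
import Data.List.Relation.Unary.Unique.Propositional.Properties as Unique
open import Data.Nat.Base as ℕ using (ℕ; zero; suc; _≤_; _<_; z≤n; s≤s)
import Data.Nat.Properties as ℕ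
open import Data.Product.Base using (Σ; ∃-syntax; _×_; _,_; proj₁; proj₂)
open import Data.Product.Properties using (≡-dec)
open import Data.Sum.Base using (_⊎_; inj₁; inj₂; [_,_]′)
import Data.Vec.Base as Vec
open import Function.Base using (_∘_; id)
open import Function.Bundles using (Equivalence)
open import Function.Definitions using (Injective)
import Function.Endo.Propositional as Endo
open import Relation.Binary.Definitions using (DecidableEquality; tri<; tri≈; tri>)
open import Relation.Binary.PropositionalEquality
open import Relation.Binary.Construct.Closure.ReflexiveTransitive using (Star; ε; _◅_)
open import Relation.Nullary using (¬_; Dec; yes; no; contradiction)
open import Relation.Nullary.Decidable using (decidable-stable; ¬?; toWitness)

private
  variable
    A B : Set
    n : ℕ

-- Divided differences of polynomials in three variables

module Polynomials where
  open import Data.Integer.Base using (ℤ; -[1+_]; 0ℤ; 1ℤ; -1ℤ; _+_; _*_; -_; _-_; _^_)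
  open import Data.Integer.Properties as ℤ using (_≟_)
  open import Data.Integer.Tactic.RingSolver using (solve-∀)
  open import Data.Nat.Tactic.RingSolver using () renaming (solve-∀ to solveℕ-∀)

  Triple : Set
  Triple = Fin 3 → ℤ

  vandermonde : ℤ → ℤ → ℤ → ℤ
  vandermonde x y z = (y - x) * ((z - x) * (z - y))

  -- The second divided difference at the points a, times their discriminant.

  μ : Triple → (ℤ → ℤ) → ℤ
  μ a f = (a 2F - a 1F) * f (a 0F) + ((a 0F - a 2F) * f (a 1F) + (a 1F - a 0F) * f (a 2F))

  moment : Triple → ℕ → ℤ
  moment a n = μ a (_^ n)

  discriminant : Triple → ℤ
  discriminant a = vandermonde (a 0F) (a 1F) (a 2F)

  μ-cong : ∀ a {f g} → (∀ t → f t ≡ g t) → μ a f ≡ μ a g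
  μ-cong a f≗g rewrite f≗g (a 0F) | f≗g (a 1F) | f≗g (a 2F) = refl

  μ-+ : ∀ a f g → μ a (λ t → f t + g t) ≡ μ a f + μ a g
  μ-+ a f g = lemma (a 2F - a 1F) (a 0F - a 2F) (a 1F - a 0F) _ _ _ _ _ _
    where
    lemma : ∀ u v w f₀ f₁ f₂ g₀ g₁ g₂ →
            u * (f₀ + g₀) + (v * (f₁ + g₁) + w * (f₂ + g₂)) ≡
            (u * f₀ + (v * f₁ + w * f₂)) + (u * g₀ + (v * g₁ + w * g₂))
    lemma = solve-∀

  μ-*ʳ : ∀ a f c → μ a (λ t → f t * c) ≡ μ a f * c
  μ-*ʳ a f c = lemma (a 2F - a 1F) (a 0F - a 2F) (a 1F - a 0F) _ _ _ c
    where
    lemma : ∀ u v w f₀ f₁ f₂ c →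
            u * (f₀ * c) + (v * (f₁ * c) + w * (f₂ * c)) ≡
            (u * f₀ + (v * f₁ + w * f₂)) * c
    lemma = solve-∀

  μ-zero : ∀ a → μ a (λ _ → 0ℤ) ≡ 0ℤ
  μ-zero a rewrite ℤ.*-zeroʳ (a 2F - a 1F) | ℤ.*-zeroʳ (a 0F - a 2F) | ℤ.*-zeroʳ (a 1F - a 0F) = refl

  μ≢0⇒∃≢0 : ∀ a f → μ a f ≢ 0ℤ → ∃[ i ] f (a i) ≢ 0ℤ
  μ≢0⇒∃≢0 a f μ≢0 with f (a 0F) ≟ 0ℤ | f (a 1F) ≟ 0ℤ | f (a 2F) ≟ 0ℤ
  ... | no p | _ | _ = 0F , p
  ... | yes _ | no p | _ = 1F , p
  ... | yes _ | yes _ | no p = 2F , p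
  ... | yes p | yes q | yes r = contradiction μ≡0 μ≢0
    where
    μ≡0 : μ a f ≡ 0ℤ
    μ≡0 rewrite p | q | r = μ-zero a

  moment-0 : ∀ a → moment a 0 ≡ 0ℤ
  moment-0 a = lemma (a 0F) (a 1F) (a 2F)
    where
    lemma : ∀ x y z → (z - y) * 1ℤ + ((x - z) * 1ℤ + (y - x) * 1ℤ) ≡ 0ℤ
    lemma = solve-∀

  moment-1 : ∀ a → moment a 1 ≡ 0ℤ
  moment-1 a = lemma (a 0F) (a 1F) (a 2F)
    where
    lemma : ∀ x y z → (z - y) * (x * 1ℤ) + ((x - z) * (y * 1ℤ) + (y - x) * (z * 1ℤ)) ≡ 0ℤ
    lemma = solve-∀

  moment-2 : ∀ a → moment a 2 ≡ discriminant a
  moment-2 a = lemma (a 0F) (a 1F) (a 2F)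
    where
    lemma : ∀ x y z → (z - y) * (x * (x * 1ℤ)) + ((x - z) * (y * (y * 1ℤ)) + (y - x) * (z * (z * 1ℤ)))
                      ≡ (y - x) * ((z - x) * (z - y))
    lemma = solve-∀

  -- Polynomials as lists of monomials, with degree bounds.

  Monomial : Set
  Monomial = ℤ × ℕ × ℕ × ℕ

  Polynomial : Set
  Polynomial = List Monomial

  degree : Monomial → ℕ
  degree (_ , i , j , k) = i ℕ.+ j ℕ.+ k

  ⟦_⟧₁ : Monomial → ℤ → ℤ → ℤ → ℤ
  ⟦ s , i , j , k ⟧₁ x y z = s * (x ^ i * (y ^ j * z ^ k))

  ⟦_⟧ : Polynomial → ℤ → ℤ → ℤ → ℤ
  ⟦ [] ⟧    x y z = 0ℤ
  ⟦ m ∷ p ⟧ x y z = ⟦ m ⟧₁ x y z + ⟦ p ⟧ x y z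

  ⟦⟧-++ : ∀ p q x y z → ⟦ p ++ q ⟧ x y z ≡ ⟦ p ⟧ x y z + ⟦ q ⟧ x y z
  ⟦⟧-++ []      q x y z = sym (ℤ.+-identityˡ _)
  ⟦⟧-++ (m ∷ p) q x y z rewrite ⟦⟧-++ p q x y z = sym (ℤ.+-assoc (⟦ m ⟧₁ x y z) _ _)

  scale : ℤ → Monomial → Monomial
  scale c (s , ijk) = c * s , ijk

  ⟦⟧-scale : ∀ c p x y z → ⟦ map (scale c) p ⟧ x y z ≡ c * ⟦ p ⟧ x y z
  ⟦⟧-scale c []      x y z = sym (ℤ.*-zeroʳ c)
  ⟦⟧-scale c ((s , i , j , k) ∷ p) x y z rewrite ⟦⟧-scale c p x y z = lemma c s _ _
    where
    lemma : ∀ c s u v → c * s * u + c * v ≡ c * (s * u + v)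
    lemma = solve-∀

  -- The bound is strict so that `HasDegree< 0` forces the zero function. The list may repeat
  -- monomials, so adding polynomials requires no cancellation.
  HasDegree< : ℕ → (ℤ → ℤ → ℤ → ℤ) → Set
  HasDegree< d f = ∃[ p ] All (λ m → degree m ℕ.< d) p × (∀ x y z → f x y z ≡ ⟦ p ⟧ x y z)

  degree<-zero : ∀ {d} → HasDegree< d (λ _ _ _ → 0ℤ)
  degree<-zero = [] , [] , λ _ _ _ → refl

  degree<-cong : ∀ {d f g} → (∀ x y z → g x y z ≡ f x y z) → HasDegree< d f → HasDegree< d g
  degree<-cong g≗f (p , ds , eq) = p , ds , λ x y z → trans (g≗f x y z) (eq x y z)

  degree<-+ : ∀ {d f g} → HasDegree< d f → HasDegree< d g → HasDegree< d (λ x y z → f x y z + g x y z)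
  degree<-+ (p , dp , ep) (q , dq , eq) =
    p ++ q , All.++⁺ dp dq , λ x y z → trans (cong₂ _+_ (ep x y z) (eq x y z)) (sym (⟦⟧-++ p q x y z))

  degree<-scale : ∀ {d f} c → HasDegree< d f → HasDegree< d (λ x y z → c * f x y z)
  degree<-scale c (p , dp , ep) =
    map (scale c) p , All.map⁺ dp , λ x y z → trans (cong (c *_) (ep x y z)) (sym (⟦⟧-scale c p x y z))

  vandermondePolynomial : Polynomial
  vandermondePolynomial =
    (1ℤ , 0 , 1 , 2) ∷ (-1ℤ , 0 , 2 , 1) ∷ (-1ℤ , 1 , 0 , 2) ∷
    (1ℤ , 2 , 0 , 1) ∷ (1ℤ , 1 , 2 , 0) ∷ (-1ℤ , 2 , 1 , 0) ∷ []

  vandermonde-expansion : ∀ x y z → vandermonde x y z ≡ ⟦ vandermondePolynomial ⟧ x y z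
  vandermonde-expansion x y z = lemma x y z
    where
    lemma : ∀ x y z → (y - x) * ((z - x) * (z - y)) ≡
      1ℤ * (1ℤ * (y * 1ℤ * (z * (z * 1ℤ)))) + (-1ℤ * (1ℤ * (y * (y * 1ℤ) * (z * 1ℤ))) +
      (-1ℤ * (x * 1ℤ * (1ℤ * (z * (z * 1ℤ)))) + (1ℤ * (x * (x * 1ℤ) * (1ℤ * (z * 1ℤ))) +
      (1ℤ * (x * 1ℤ * (y * (y * 1ℤ) * 1ℤ)) + (-1ℤ * (x * (x * 1ℤ) * (y * 1ℤ * 1ℤ)) + 0ℤ)))))
    lemma = solve-∀

  -- A monomial in the three remaining variables, together with the exponents
  -- of the three variables that are eliminated.

  Term : Set
  Term = (ℕ × ℕ × ℕ) × Monomial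

  totalDegree : Term → ℕ
  totalDegree ((n₁ , n₂ , n₃) , m) = n₁ ℕ.+ n₂ ℕ.+ n₃ ℕ.+ degree m

  quadratic? : (t : Term) → Dec (proj₁ t ≡ (2 , 2 , 2))
  quadratic? ((n₁ , n₂ , n₃) , _) with n₁ ℕ.≟ 2 | n₂ ℕ.≟ 2 | n₃ ℕ.≟ 2
  ... | yes refl | yes refl | yes refl = yes refl
  ... | no ≢2 | _ | _ = no λ { refl → ≢2 refl }
  ... | _ | no ≢2 | _ = no λ { refl → ≢2 refl }
  ... | _ | _ | no ≢2 = no λ { refl → ≢2 refl }

  leading : List Term → Polynomial
  leading [] = []
  leading (t ∷ ts) with quadratic? t
  ... | yes _ = proj₂ t ∷ leading ts
  ... | no  _ = leading ts

  -- Eliminating three variables by divided differences.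

  module Elimination (a b c : Triple) where

    eliminate₁ : Term → ℤ → ℤ → ℤ → ℤ
    eliminate₁ ((n₁ , n₂ , n₃) , m) x y z =
      moment a n₁ * (moment b n₂ * (moment c n₃ * ⟦ m ⟧₁ x y z))

    eliminate : List Term → ℤ → ℤ → ℤ → ℤ
    eliminate []       x y z = 0ℤ
    eliminate (t ∷ ts) x y z = eliminate₁ t x y z + eliminate ts x y z

    discriminants : ℤ
    discriminants = discriminant a * discriminant b * discriminant c

    moment-small : ∀ a {n} → n ℕ.< 2 → moment a n ≡ 0ℤ
    moment-small a {0} _ = moment-0 a
    moment-small a {1} _ = moment-1 a
    moment-small a {suc (suc _)} (s≤s (s≤s ()))

    -- Moments of order 0 and 1 vanish, so an exponent below two in any eliminated variable
    -- annihilates the term. The degree of `m` matters only when all three exponents are at least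
    -- two.
    eliminate₁-degree : ∀ {d} (((n₁ , n₂ , n₃) , m) : Term) →
                        (2 ≤ n₁ → 2 ≤ n₂ → 2 ≤ n₃ → degree m ℕ.< d) →
                        HasDegree< d (eliminate₁ ((n₁ , n₂ , n₃) , m))
    eliminate₁-degree {d} ((n₁ , n₂ , n₃) , m) m<
      with n₁ ℕ.<? 2 | n₂ ℕ.<? 2 | n₃ ℕ.<? 2
    ... | yes n< | _ | _ = degree<-cong (λ x y z → cong (_* _) (moment-small a n<)) degree<-zero
    ... | _ | yes n< | _ = degree<-cong (λ x y z →
      trans (cong (λ v → moment a n₁ * (v * _)) (moment-small b n<)) (ℤ.*-zeroʳ (moment a n₁))) degree<-zero
    ... | _ | _ | yes n< = degree<-cong (λ x y z →
      trans (cong (λ v → moment a n₁ * (moment b n₂ * (v * _))) (moment-small c n<))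
      (trans (cong (moment a n₁ *_) (ℤ.*-zeroʳ (moment b n₂))) (ℤ.*-zeroʳ (moment a n₁)))) degree<-zero
    ... | no n₁≮2 | no n₂≮2 | no n₃≮2 =
      degree<-scale (moment a n₁) (degree<-scale (moment b n₂) (degree<-scale (moment c n₃)
        (m ∷ [] , m< (ℕ.≮⇒≥ n₁≮2) (ℕ.≮⇒≥ n₂≮2) (ℕ.≮⇒≥ n₃≮2) ∷ [] , λ x y z → sym (ℤ.+-identityʳ _))))

    -- A surviving term has spent degree at least six on the eliminated variables.
    eliminate₁-low : ∀ {d} t → totalDegree t ℕ.< 6 ℕ.+ d → HasDegree< d (eliminate₁ t)
    eliminate₁-low t t< = eliminate₁-degree t λ 2≤n₁ 2≤n₂ 2≤n₃ → ℕ.+-cancelˡ-< 6 _ _ (ℕ.≤-<-trans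
      (ℕ.+-monoˡ-≤ (degree (proj₂ t)) (ℕ.+-mono-≤ (ℕ.+-mono-≤ 2≤n₁ 2≤n₂) 2≤n₃)) t<)

    eliminate-low : ∀ {d} ts → All (λ t → totalDegree t ℕ.< 6 ℕ.+ d) ts → HasDegree< d (eliminate ts)
    eliminate-low []       []        = degree<-zero
    eliminate-low (t ∷ ts) (t< ∷ <s) = degree<-+ (eliminate₁-low t t<) (eliminate-low ts <s)

    -- Only terms quadratic in every eliminated variable keep the top degree.

    eliminate₁-nonquadratic : ∀ {d} t → proj₁ t ≢ (2 , 2 , 2) → totalDegree t ≤ 6 ℕ.+ d →
                              HasDegree< d (eliminate₁ t)
    eliminate₁-nonquadratic {d} t@((n₁ , n₂ , n₃) , m) ≢222 t≤ = eliminate₁-degree t low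
      where
      low : 2 ≤ n₁ → 2 ≤ n₂ → 2 ≤ n₃ → degree m ℕ.< d
      low 2≤n₁ 2≤n₂ 2≤n₃ = ℕ.≰⇒> λ d≤m →
        let Σ≤6 : n₁ ℕ.+ n₂ ℕ.+ n₃ ≤ 6
            Σ≤6 = ℕ.+-cancelʳ-≤ d _ _ (ℕ.≤-trans (ℕ.+-monoʳ-≤ (n₁ ℕ.+ n₂ ℕ.+ n₃) d≤m) t≤)
            n₃≤2 = ℕ.+-cancelˡ-≤ 4 _ _ (ℕ.≤-trans (ℕ.+-monoˡ-≤ n₃ (ℕ.+-mono-≤ 2≤n₁ 2≤n₂)) Σ≤6)
            n₁+n₂≤4 = ℕ.+-cancelʳ-≤ 2 _ _ (ℕ.≤-trans (ℕ.+-monoʳ-≤ (n₁ ℕ.+ n₂) 2≤n₃) Σ≤6)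
            n₂≤2 = ℕ.+-cancelˡ-≤ 2 _ _ (ℕ.≤-trans (ℕ.+-monoˡ-≤ n₂ 2≤n₁) n₁+n₂≤4)
            n₁≤2 = ℕ.+-cancelʳ-≤ 2 _ _ (ℕ.≤-trans (ℕ.+-monoʳ-≤ n₁ 2≤n₂) n₁+n₂≤4)
        in ≢222 (cong₂ _,_ (ℕ.≤-antisym n₁≤2 2≤n₁)
                           (cong₂ _,_ (ℕ.≤-antisym n₂≤2 2≤n₂) (ℕ.≤-antisym n₃≤2 2≤n₃)))

    -- The second moment is the discriminant, so each term quadratic in all three eliminated
    -- variables is multiplied by exactly `discriminants`. All other terms fall below degree d and
    -- are collected in `r`.
    eliminate-leading : ∀ {d} ts → All (λ t → totalDegree t ≤ 6 ℕ.+ d) ts →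
                        ∃[ r ] HasDegree< d r ×
                        (∀ x y z → eliminate ts x y z ≡ discriminants * ⟦ leading ts ⟧ x y z + r x y z)
    eliminate-leading [] [] = (λ _ _ _ → 0ℤ) , degree<-zero , λ x y z →
      sym (trans (ℤ.+-identityʳ _) (ℤ.*-zeroʳ discriminants))
    eliminate-leading (t ∷ ts) (t≤ ∷ ≤s) with quadratic? t | eliminate-leading ts ≤s
    ... | no ≢222 | r , r< , eq =
      (λ x y z → eliminate₁ t x y z + r x y z) ,
      degree<-+ (eliminate₁-nonquadratic t ≢222 t≤) r< ,
      λ x y z → trans (cong (λ v → eliminate₁ t x y z + v) (eq x y z))
                          (lemma (eliminate₁ t x y z) (discriminants * ⟦ leading ts ⟧ x y z) (r x y z))
      where
      lemma : ∀ u v w → u + (v + w) ≡ v + (u + w)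
      lemma = solve-∀
    ... | yes refl | r , r< , eq = r , r< , λ x y z →
      trans (cong₂ _+_ (cong₂ _*_ (moment-2 a) (cong₂ _*_ (moment-2 b) (cong (_* ⟦ proj₂ t ⟧₁ x y z) (moment-2 c))))
                       (eq x y z))
            (lemma (discriminant a) (discriminant b) (discriminant c) (⟦ proj₂ t ⟧₁ x y z) (⟦ leading ts ⟧ x y z) (r x y z))
      where
      lemma : ∀ u v w m l r → u * (v * (w * m)) + (u * v * w * l + r) ≡ u * v * w * (m + l) + r
      lemma = solve-∀

    μ³ : (ℤ → ℤ → ℤ → ℤ) → ℤ
    μ³ f = μ a λ u → μ b λ v → μ c λ w → f u v w

    μ³-cong : ∀ {f g} → (∀ u v w → f u v w ≡ g u v w) → μ³ f ≡ μ³ g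
    μ³-cong f≗g = μ-cong a λ u → μ-cong b λ v → μ-cong c λ w → f≗g u v w

    μ³-+ : ∀ f g → μ³ (λ u v w → f u v w + g u v w) ≡ μ³ f + μ³ g
    μ³-+ f g =
      trans (μ-cong a λ u → trans (μ-cong b λ v → μ-+ c (f u v) (g u v))
                                  (μ-+ b (λ v → μ c (f u v)) (λ v → μ c (g u v))))
            (μ-+ a (λ u → μ b λ v → μ c (f u v)) (λ u → μ b λ v → μ c (g u v)))

    μ³-*ʳ : ∀ f k → μ³ (λ u v w → f u v w * k) ≡ μ³ f * k
    μ³-*ʳ f k =
      trans (μ-cong a λ u → trans (μ-cong b λ v → μ-*ʳ c (f u v) k)
                                  (μ-*ʳ b (λ v → μ c (f u v)) k))
            (μ-*ʳ a (λ u → μ b λ v → μ c (f u v)) k)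

    -- As in the Combinatorial Nullstellensatz, a nonzero weighted sum over all triples of points
    -- yields a single triple where f does not vanish.
    μ³-≢0 : ∀ f → μ³ f ≢ 0ℤ → ∃[ i ] ∃[ j ] ∃[ k ] f (a i) (b j) (c k) ≢ 0ℤ
    μ³-≢0 f ≢0 =
      let i , ≢0 = μ≢0⇒∃≢0 a (λ u → μ b λ v → μ c (f u v)) ≢0
          j , ≢0 = μ≢0⇒∃≢0 b (λ v → μ c (f (a i) v)) ≢0
          k , ≢0 = μ≢0⇒∃≢0 c (f (a i) (b j)) ≢0
      in i , j , k , ≢0

    -- The monomial before elimination: u, v, w are to be summed out, while x, y, z survive.
    term : Term → (x y z u v w : ℤ) → ℤ
    term ((n₁ , n₂ , n₃) , m) x y z u v w = u ^ n₁ * (v ^ n₂ * (w ^ n₃ * ⟦ m ⟧₁ x y z))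

    terms : List Term → (x y z u v w : ℤ) → ℤ
    terms []       x y z u v w = 0ℤ
    terms (t ∷ ts) x y z u v w = term t x y z u v w + terms ts x y z u v w

    μ³-term : ∀ t x y z → μ³ (term t x y z) ≡ eliminate₁ t x y z
    μ³-term ((n₁ , n₂ , n₃) , m) x y z =
      trans (μ-cong a λ u → trans (μ-cong b λ v →
          trans (μ-cong c λ w → lemma (u ^ n₁) (v ^ n₂) (w ^ n₃) k) (μ-*ʳ c (_^ n₃) (k * v ^ n₂ * u ^ n₁)))
        (trans (μ-cong b λ v → lemma′ (u ^ n₁) (v ^ n₂) (moment c n₃) k)
               (μ-*ʳ b (_^ n₂) (k * moment c n₃ * u ^ n₁))))
      (trans (μ-cong a λ u → lemma″ (u ^ n₁) (moment b n₂) (moment c n₃) k)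
        (μ-*ʳ a (_^ n₁) (moment b n₂ * (moment c n₃ * k))))
      where
      k = ⟦ m ⟧₁ x y z
      lemma : ∀ u v w k → u * (v * (w * k)) ≡ w * (k * v * u)
      lemma = solve-∀
      lemma′ : ∀ u v w k → w * (k * v * u) ≡ v * (k * w * u)
      lemma′ = solve-∀
      lemma″ : ∀ u v w k → v * (k * w * u) ≡ u * (v * (w * k))
      lemma″ = solve-∀

    μ³-terms : ∀ ts x y z → μ³ (terms ts x y z) ≡ eliminate ts x y z
    μ³-terms [] x y z = trans (μ-cong a λ u → trans (μ-cong b λ v → μ-zero c) (μ-zero b)) (μ-zero a)
    μ³-terms (t ∷ ts) x y z =
      trans (μ³-+ (term t x y z) (terms ts x y z)) (cong₂ _+_ (μ³-term t x y z) (μ³-terms ts x y z))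

    terms-++ : ∀ ts us x y z u v w →
               terms (ts ++ us) x y z u v w ≡ terms ts x y z u v w + terms us x y z u v w
    terms-++ []       us x y z u v w = sym (ℤ.+-identityˡ _)
    terms-++ (t ∷ ts) us x y z u v w rewrite terms-++ ts us x y z u v w =
      sym (ℤ.+-assoc (term t x y z u v w) _ _)

    -- Two branches f and g meet at a vertex below the edge e. Their root edges are e₁ and e₂, the
    -- rim edge between them is x, and h governs the three edges at the vertex.
    compose : (f g h : ℤ → ℤ → ℤ → ℤ) → ℤ → ℤ → ℤ → ℤ
    compose f g h l e r = μ³ λ e₁ e₂ x → f l e₁ x * (g x e₂ r * h e e₁ e₂)

    -- Each eliminated variable occurs in two factors: e₁ in the first and third, e₂ in the second
    -- and third, x in the first and second. Each of l, e, r occurs in one.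
    composeTerm : Monomial → Monomial → Monomial → Term
    composeTerm (α , i , j , k) (β , i′ , j′ , k′) (γ , i″ , j″ , k″) =
      (j ℕ.+ j″ , j′ ℕ.+ k″ , k ℕ.+ i′) , (α * β * γ , i , i″ , k′)

    composeTerms : Polynomial → Polynomial → Polynomial → List Term
    composeTerms p q s = concatMap (λ m → concatMap (λ m′ → map (composeTerm m m′) s) q) p

    composeTerms-correct : ∀ p q s l e r e₁ e₂ x →
      ⟦ p ⟧ l e₁ x * (⟦ q ⟧ x e₂ r * ⟦ s ⟧ e e₁ e₂) ≡ terms (composeTerms p q s) l e r e₁ e₂ x
    composeTerms-correct p q s l e r e₁ e₂ x = fst p
      where
      third : ∀ m m′ s → ⟦ m ⟧₁ l e₁ x * (⟦ m′ ⟧₁ x e₂ r * ⟦ s ⟧ e e₁ e₂) ≡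
                         terms (map (composeTerm m m′) s) l e r e₁ e₂ x
      third m m′ [] = trans (cong (⟦ m ⟧₁ l e₁ x *_) (ℤ.*-zeroʳ (⟦ m′ ⟧₁ x e₂ r))) (ℤ.*-zeroʳ (⟦ m ⟧₁ l e₁ x))
      third m@(α , i , j , k) m′@(β , i′ , j′ , k′) ((γ , i″ , j″ , k″) ∷ s)
        rewrite sym (third m m′ s) | ℤ.^-distribˡ-+-* e₁ j j″ | ℤ.^-distribˡ-+-* e₂ j′ k″ | ℤ.^-distribˡ-+-* x k i′ =
        lemma α (l ^ i) (e₁ ^ j) (x ^ k) β (x ^ i′) (e₂ ^ j′) (r ^ k′) γ (e ^ i″) (e₁ ^ j″) (e₂ ^ k″) _
        where
        lemma : ∀ α a b c β d e f γ g h i S →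
                α * (a * (b * c)) * (β * (d * (e * f)) * (γ * (g * (h * i)) + S)) ≡
                b * h * (e * i * (c * d * (α * β * γ * (a * (g * f))))) +
                α * (a * (b * c)) * (β * (d * (e * f)) * S)
        lemma = solve-∀
      snd : ∀ m q → ⟦ m ⟧₁ l e₁ x * (⟦ q ⟧ x e₂ r * ⟦ s ⟧ e e₁ e₂) ≡
                    terms (concatMap (λ m′ → map (composeTerm m m′) s) q) l e r e₁ e₂ x
      snd m [] = ℤ.*-zeroʳ (⟦ m ⟧₁ l e₁ x)
      snd m (m′ ∷ q) = trans (lemma (⟦ m ⟧₁ l e₁ x) (⟦ m′ ⟧₁ x e₂ r) (⟦ q ⟧ x e₂ r) (⟦ s ⟧ e e₁ e₂))
        (trans (cong₂ _+_ (third m m′ s) (snd m q)) (sym (terms-++ (map (composeTerm m m′) s) _ l e r e₁ e₂ x)))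
        where
        lemma : ∀ a b c d → a * ((b + c) * d) ≡ a * (b * d) + a * (c * d)
        lemma = solve-∀
      fst : ∀ p → ⟦ p ⟧ l e₁ x * (⟦ q ⟧ x e₂ r * ⟦ s ⟧ e e₁ e₂) ≡ terms (composeTerms p q s) l e r e₁ e₂ x
      fst [] = refl
      fst (m ∷ p) = trans (ℤ.*-distribʳ-+ _ (⟦ m ⟧₁ l e₁ x) (⟦ p ⟧ l e₁ x))
        (trans (cong₂ _+_ (snd m q) (fst p)) (sym (terms-++ (concatMap (λ m′ → map (composeTerm m m′) s) q) _ l e r e₁ e₂ x)))

    compose-polynomials : ∀ p q s l e r → compose ⟦ p ⟧ ⟦ q ⟧ ⟦ s ⟧ l e r ≡ eliminate (composeTerms p q s) l e r
    compose-polynomials p q s l e r =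
      trans (μ³-cong (composeTerms-correct p q s l e r)) (μ³-terms (composeTerms p q s) l e r)

    compose-cong : ∀ {f f′ g g′ h h′} →
      (∀ x y z → f x y z ≡ f′ x y z) → (∀ x y z → g x y z ≡ g′ x y z) → (∀ x y z → h x y z ≡ h′ x y z) →
      ∀ x y z → compose f g h x y z ≡ compose f′ g′ h′ x y z
    compose-cong f≗ g≗ h≗ x y z = μ³-cong λ u v w → cong₂ _*_ (f≗ x u w) (cong₂ _*_ (g≗ w v z) (h≗ y u v))

    composeTerm-degree : ∀ m m′ m″ → totalDegree (composeTerm m m′ m″) ≡ degree m ℕ.+ degree m′ ℕ.+ degree m″
    composeTerm-degree (_ , i , j , k) (_ , i′ , j′ , k′) (_ , i″ , j″ , k″) = lemma i j k i′ j′ k′ i″ j″ k″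
      where
      lemma : ∀ i j k i′ j′ k′ i″ j″ k″ →
              (j ℕ.+ j″) ℕ.+ (j′ ℕ.+ k″) ℕ.+ (k ℕ.+ i′) ℕ.+ (i ℕ.+ i″ ℕ.+ k′) ≡
              (i ℕ.+ j ℕ.+ k) ℕ.+ (i′ ℕ.+ j′ ℕ.+ k′) ℕ.+ (i″ ℕ.+ j″ ℕ.+ k″)
      lemma = solveℕ-∀

    composeTerms-degree : ∀ {a b c p q s} → All (λ m → degree m ≤ a) p → All (λ m → degree m ≤ b) q →
                          All (λ m → degree m ≤ c) s →
                          All (λ t → totalDegree t ≤ a ℕ.+ b ℕ.+ c) (composeTerms p q s)
    composeTerms-degree ps qs ss =
      All.concat⁺ (All.map⁺ (All.map (λ {m} ≤a →
        All.concat⁺ (All.map⁺ (All.map (λ {m′} ≤b →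
          All.map⁺ (All.map (λ {m″} ≤c →
            ℕ.≤-trans (ℕ.≤-reflexive (composeTerm-degree m m′ m″)) (ℕ.+-mono-≤ (ℕ.+-mono-≤ ≤a ≤b) ≤c)) ss)) qs))) ps))

    compose-low : ∀ {d i j k f g h} → i ℕ.+ j ℕ.+ k ℕ.< 6 ℕ.+ d →
                  HasDegree< (suc i) f → HasDegree< (suc j) g → HasDegree< (suc k) h →
                  HasDegree< d (compose f g h)
    compose-low ijk< (p , ps , f≗) (q , qs , g≗) (s , ss , h≗) =
      degree<-cong (λ x y z → trans (compose-cong f≗ g≗ h≗ x y z) (compose-polynomials p q s x y z))
        (eliminate-low (composeTerms p q s)
          (All.map (λ t≤ → ℕ.≤-<-trans t≤ ijk<)
            (composeTerms-degree (All.map ℕ.s≤s⁻¹ ps) (All.map ℕ.s≤s⁻¹ qs) (All.map ℕ.s≤s⁻¹ ss))))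

    close : (f g : ℤ → ℤ → ℤ → ℤ) → ℤ
    close f g = μ³ λ l e r → f l e r * g l e r

    closeTerm : Monomial → Monomial → Term
    closeTerm (α , i , j , k) (β , i′ , j′ , k′) = (i ℕ.+ i′ , j ℕ.+ j′ , k ℕ.+ k′) , (α * β , 0 , 0 , 0)

    closeTerms : Polynomial → Polynomial → List Term
    closeTerms p q = concatMap (λ m → map (closeTerm m) q) p

    closeTerms-correct : ∀ p q x y z l e r →
      ⟦ p ⟧ l e r * ⟦ q ⟧ l e r ≡ terms (closeTerms p q) x y z l e r
    closeTerms-correct p q x y z l e r = fst p
      where
      snd : ∀ m q → ⟦ m ⟧₁ l e r * ⟦ q ⟧ l e r ≡ terms (map (closeTerm m) q) x y z l e r
      snd m [] = ℤ.*-zeroʳ (⟦ m ⟧₁ l e r)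
      snd m@(α , i , j , k) ((β , i′ , j′ , k′) ∷ q)
        rewrite sym (snd m q) | ℤ.^-distribˡ-+-* l i i′ | ℤ.^-distribˡ-+-* e j j′ | ℤ.^-distribˡ-+-* r k k′ =
        lemma α (l ^ i) (e ^ j) (r ^ k) β (l ^ i′) (e ^ j′) (r ^ k′) _
        where
        lemma : ∀ α a b c β d e f S →
                α * (a * (b * c)) * (β * (d * (e * f)) + S) ≡
                a * d * (b * e * (c * f * (α * β * (1ℤ * (1ℤ * 1ℤ))))) + α * (a * (b * c)) * S
        lemma = solve-∀
      fst : ∀ p → ⟦ p ⟧ l e r * ⟦ q ⟧ l e r ≡ terms (closeTerms p q) x y z l e r
      fst [] = refl
      fst (m ∷ p) = trans (ℤ.*-distribʳ-+ _ (⟦ m ⟧₁ l e r) (⟦ p ⟧ l e r))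
        (trans (cong₂ _+_ (snd m q) (fst p)) (sym (terms-++ (map (closeTerm m) q) _ x y z l e r)))

    closeTerms-degree : ∀ {a b p q} → All (λ m → degree m ≤ a) p → All (λ m → degree m ≤ b) q →
                        All (λ t → totalDegree t ≤ a ℕ.+ b) (closeTerms p q)
    closeTerms-degree ps qs =
      All.concat⁺ (All.map⁺ (All.map (λ {m} ≤a → All.map⁺ (All.map (λ {m′} ≤b →
        ℕ.≤-trans (ℕ.≤-reflexive (closeTerm-degree m m′)) (ℕ.+-mono-≤ ≤a ≤b)) qs)) ps))
      where
      closeTerm-degree : ∀ m m′ → totalDegree (closeTerm m m′) ≡ degree m ℕ.+ degree m′
      closeTerm-degree (_ , i , j , k) (_ , i′ , j′ , k′) = lemma i j k i′ j′ k′
        where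
        lemma : ∀ i j k i′ j′ k′ → i ℕ.+ i′ ℕ.+ (j ℕ.+ j′) ℕ.+ (k ℕ.+ k′) ℕ.+ 0 ≡ (i ℕ.+ j ℕ.+ k) ℕ.+ (i′ ℕ.+ j′ ℕ.+ k′)
        lemma = solveℕ-∀

    close-polynomials : ∀ {f g p q} → (∀ x y z → f x y z ≡ ⟦ p ⟧ x y z) → (∀ x y z → g x y z ≡ ⟦ q ⟧ x y z) →
                        close f g ≡ eliminate (closeTerms p q) 0ℤ 0ℤ 0ℤ
    close-polynomials {p = p} {q} f≗ g≗ =
      trans (μ³-cong λ l e r → trans (cong₂ _*_ (f≗ l e r) (g≗ l e r)) (closeTerms-correct p q 0ℤ 0ℤ 0ℤ l e r))
            (μ³-terms (closeTerms p q) 0ℤ 0ℤ 0ℤ)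

    degree<0⇒≡0 : ∀ {f} → HasDegree< 0 f → ∀ x y z → f x y z ≡ 0ℤ
    degree<0⇒≡0 ([] , [] , f≗) = f≗
    degree<0⇒≡0 (_ ∷ _ , () ∷ _ , _)

    close-low : ∀ {i j f g} → i ℕ.+ j ℕ.< 6 → HasDegree< (suc i) f → HasDegree< (suc j) g → close f g ≡ 0ℤ
    close-low ij< (p , ps , f≗) (q , qs , g≗) = trans (close-polynomials {p = p} {q} f≗ g≗) (degree<0⇒≡0
      (eliminate-low (closeTerms p q) (All.map (λ t≤ → ℕ.≤-<-trans t≤ ij<)
        (closeTerms-degree (All.map ℕ.s≤s⁻¹ ps) (All.map ℕ.s≤s⁻¹ qs)))) 0ℤ 0ℤ 0ℤ)

    vandermonde-degree : HasDegree< 4 vandermonde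
    vandermonde-degree = vandermondePolynomial ,
      toWitness {a? = All.all? (λ m → degree m ℕ.<? 4) vandermondePolynomial} _ , vandermonde-expansion

    -- The product has degree nine, and its coefficient at e₁² e₂² x² is again the Vandermonde
    -- polynomial up to sign.
    compose-vandermonde : ∃[ r ] HasDegree< 3 r × (∀ x y z →
      compose vandermonde vandermonde vandermonde x y z ≡ - discriminants * vandermonde x y z + r x y z)
    compose-vandermonde =
      let r , r< , eq = eliminate-leading (composeTerms p p p) (composeTerms-degree ≤3 ≤3 ≤3)
      in r , r< , λ x y z →
        trans (compose-cong vandermonde-expansion vandermonde-expansion vandermonde-expansion x y z)
        (trans (compose-polynomials p p p x y z)
        (trans (eq x y z) (cong (_+ r x y z) (lemma discriminants x y z))))
      where
      p = vandermondePolynomial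
      ≤3 : All (λ m → degree m ≤ 3) p
      ≤3 = toWitness {a? = All.all? (λ m → degree m ℕ.≤? 3) p} _
      -- These eight terms are the value of `leading`; the two multiples of x y z cancel.
      lemma : ∀ s x y z → s * (
        1ℤ * (1ℤ * (y * (y * 1ℤ) * (z * 1ℤ))) + (-1ℤ * (1ℤ * (y * 1ℤ * (z * (z * 1ℤ)))) +
        (1ℤ * (x * 1ℤ * (1ℤ * (z * (z * 1ℤ)))) + (1ℤ * (x * 1ℤ * (y * 1ℤ * (z * 1ℤ))) +
        (1ℤ * (x * (x * 1ℤ) * (y * 1ℤ * 1ℤ)) + (-1ℤ * (x * 1ℤ * (y * 1ℤ * (z * 1ℤ))) +
        (-1ℤ * (x * 1ℤ * (y * (y * 1ℤ) * 1ℤ)) + (-1ℤ * (x * (x * 1ℤ) * (1ℤ * (z * 1ℤ))) + 0ℤ))))))))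
        ≡ - s * ((y - x) * ((z - x) * (z - y)))
      lemma = solve-∀

    -- The coefficient of x² y² z² in the squared Vandermonde polynomial is -6: each of the six
    -- monomials pairs with a complementary one of opposite sign.
    close-vandermonde : close vandermonde vandermonde ≡ discriminants * -[1+ 5 ]
    close-vandermonde =
      -- For d = 0 the remainder has degree below zero, so it vanishes.
      let r , r< , eq = eliminate-leading {d = 0} (closeTerms p p) (closeTerms-degree ≤3 ≤3)
      in trans (close-polynomials {p = p} {p} vandermonde-expansion vandermonde-expansion)
        (trans (eq 0ℤ 0ℤ 0ℤ) (trans (cong (λ v → discriminants * -[1+ 5 ] + v) (degree<0⇒≡0 r< 0ℤ 0ℤ 0ℤ)) (ℤ.+-identityʳ _)))
      where
      p = vandermondePolynomial
      ≤3 : All (λ m → degree m ≤ 3) p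
      ≤3 = toWitness {a? = All.all? (λ m → degree m ℕ.≤? 3) p} _

  -- Polynomials whose leading form is a multiple of the Vandermonde polynomial.

  *-≢0 : ∀ {i j} → i ≢ 0ℤ → j ≢ 0ℤ → i * j ≢ 0ℤ
  *-≢0 {i} i≢0 j≢0 ij≡0 with ℤ.i*j≡0⇒i≡0∨j≡0 i ij≡0
  ... | inj₁ i≡0 = i≢0 i≡0
  ... | inj₂ j≡0 = j≢0 j≡0

  VandermondeLike : (ℤ → ℤ → ℤ → ℤ) → Set
  VandermondeLike f = ∃[ c ] ∃[ r ] c ≢ 0ℤ × HasDegree< 3 r × (∀ x y z → f x y z ≡ c * vandermonde x y z + r x y z)

  vandermonde-like : VandermondeLike vandermonde
  vandermonde-like = 1ℤ , (λ _ _ _ → 0ℤ) , (λ ()) , degree<-zero , λ x y z →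
    sym (trans (ℤ.+-identityʳ _) (ℤ.*-identityˡ _))

  degree<-weaken : ∀ {d d′ f} → d ≤ d′ → HasDegree< d f → HasDegree< d′ f
  degree<-weaken d≤d′ (p , ps , eq) = p , All.map (λ m< → ℕ.<-≤-trans m< d≤d′) ps , eq

  module _ (a b c : Triple) (a≢0 : discriminant a ≢ 0ℤ) (b≢0 : discriminant b ≢ 0ℤ) (c≢0 : discriminant c ≢ 0ℤ) where
    open Elimination a b c

    discriminants≢0 : discriminants ≢ 0ℤ
    discriminants≢0 = *-≢0 (*-≢0 a≢0 b≢0) c≢0

    -- Write f = s V + p and g = t V + q. The product of three Vandermonde polynomials supplies the
    -- new leading form. Products involving p or q have degree at most 8, and elimination leaves at
    -- most 2 of it.
    compose-like : ∀ {f g} → VandermondeLike f → VandermondeLike g → VandermondeLike (compose f g vandermonde)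
    compose-like {f} {g} (s , p , s≢0 , p< , f≗) (t , q , t≢0 , q< , g≗) =
      let r , r< , eq = compose-vandermonde in
      s * t * - discriminants ,
      (λ x y z → (s * t * r x y z + s * compose vandermonde q vandermonde x y z) + compose p g vandermonde x y z) ,
      *-≢0 (*-≢0 s≢0 t≢0) (λ eq → discriminants≢0 (ℤ.neg-injective eq)) ,
      degree<-+ (degree<-+ (degree<-scale (s * t) r<)
                           (degree<-scale s (compose-low 3+2+3<9 vandermonde-degree q< vandermonde-degree)))
                (compose-low 2+3+3<9 p< g< vandermonde-degree) ,
      λ x y z → trans (expand x y z) 
        (trans (cong (λ v → s * t * v + s * compose vandermonde q vandermonde x y z + compose p g vandermonde x y z) (eq x y z))
               (lemma (s * t) discriminants (vandermonde x y z) (r x y z)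
                      (s * compose vandermonde q vandermonde x y z) (compose p g vandermonde x y z)))
      where
      3+2+3<9 : 3 ℕ.+ 2 ℕ.+ 3 ℕ.< 9
      3+2+3<9 = ℕ.≤-refl
      2+3+3<9 : 2 ℕ.+ 3 ℕ.+ 3 ℕ.< 9
      2+3+3<9 = ℕ.≤-refl
      g< : HasDegree< 4 g
      g< = degree<-cong g≗ (degree<-+ (degree<-scale t vandermonde-degree) (degree<-weaken (ℕ.n≤1+n 3) q<))
      lemma : ∀ k σ v r u w → k * (- σ * v + r) + u + w ≡ k * - σ * v + (k * r + u + w)
      lemma = solve-∀
      expand : ∀ x y z → compose f g vandermonde x y z ≡
        s * t * compose vandermonde vandermonde vandermonde x y z +
        s * compose vandermonde q vandermonde x y z + compose p g vandermonde x y z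
      expand x y z =
        trans (μ³-cong λ u v w → trans (cong (_* (g w v z * vandermonde y u v)) (f≗ x u w))
                (trans (lemma₁ s (vandermonde x u w) (p x u w) (g w v z * vandermonde y u v))
                       (cong (_+ p x u w * (g w v z * vandermonde y u v))
                         (trans (cong (λ k → vandermonde x u w * (k * vandermonde y u v) * s) (g≗ w v z))
                                (lemma₂ s t (vandermonde x u w) (vandermonde w v z) (q w v z) (vandermonde y u v))))))
        (trans (μ³-+ (λ u v w → V³ u v w * (s * t) + VqV u v w * s) pgV)
          (cong (_+ compose p g vandermonde x y z)
            (trans (μ³-+ (λ u v w → V³ u v w * (s * t)) (λ u v w → VqV u v w * s))
              (cong₂ _+_ (trans (μ³-*ʳ V³ (s * t)) (ℤ.*-comm _ (s * t))) (trans (μ³-*ʳ VqV s) (ℤ.*-comm _ s))))))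
        where
        V³ VqV pgV : ℤ → ℤ → ℤ → ℤ
        V³ u v w = vandermonde x u w * (vandermonde w v z * vandermonde y u v)
        VqV u v w = vandermonde x u w * (q w v z * vandermonde y u v)
        pgV u v w = p x u w * (g w v z * vandermonde y u v)
        lemma₁ : ∀ s V p G → (s * V + p) * G ≡ V * G * s + p * G
        lemma₁ = solve-∀
        lemma₂ : ∀ s t V W q U → V * ((t * W + q) * U) * s ≡ V * (W * U) * (s * t) + V * (q * U) * s
        lemma₂ = solve-∀

    -- With f = s V + p, the product p V has degree at most 5 and is killed by the loss of six
    -- degrees. What remains is -6 s times the discriminants.
    close-like : ∀ {f} → VandermondeLike f → close f vandermonde ≢ 0ℤ
    close-like {f} (s , p , s≢0 , p< , f≗) close≡0 =
      *-≢0 s≢0 (*-≢0 discriminants≢0 (λ ())) (trans (sym close≡) close≡0)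
      where
      lemma : ∀ s v p → (s * v + p) * v ≡ v * v * s + p * v
      lemma = solve-∀
      close≡ : close f vandermonde ≡ s * (discriminants * -[1+ 5 ])
      close≡ =
        trans (μ³-cong λ u v w → trans (cong (_* vandermonde u v w) (f≗ u v w)) (lemma s (vandermonde u v w) (p u v w)))
        (trans (μ³-+ (λ u v w → vandermonde u v w * vandermonde u v w * s) (λ u v w → p u v w * vandermonde u v w))
        (trans (cong₂ _+_ (trans (μ³-*ʳ (λ u v w → vandermonde u v w * vandermonde u v w) s)
                                 (trans (ℤ.*-comm _ s) (cong (s *_) close-vandermonde)))
                          (close-low ℕ.≤-refl p< vandermonde-degree))
          (ℤ.+-identityʳ _)))

open Polynomials using (Triple; vandermonde; discriminant; *-≢0; module Elimination)
open Polynomials using (VandermondeLike; vandermonde-like; compose-like; close-like)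

-- Colouring plane trees from palettes

-- Lists with at least k colours are cut down to k of them, so counting colours becomes comparing
-- injections out of `Fin k`.
record Palette (k : ℕ) : Set where
  field
    colour    : Fin k → ℕ
    injective : Injective _≡_ _≡_ colour

open Palette

_∈ᵖ_ : ∀ {k} → ℕ → Palette k → Set
c ∈ᵖ p = ∃[ i ] colour p i ≡ c

_∈ᵖ?_ : ∀ {k} c (p : Palette k) → Dec (c ∈ᵖ p)
c ∈ᵖ? p = Fin.any? (λ i → colour p i ℕ.≟ c)

palette-⊆⇒≤ : ∀ {k} (p : Palette k) ys → (∀ i → colour p i ∈ ys) → k ≤ length ys
palette-⊆⇒≤ p ys ⊆ys = Fin.injective⇒≤ {f = λ i → Any.index (⊆ys i)} λ {i} {j} eq →
  injective p (trans (Any.lookup-index (⊆ys i)) (trans (cong (lookup ys) eq) (sym (Any.lookup-index (⊆ys j)))))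

pick : ∀ {k} (p : Palette k) ys → length ys < k → ∃[ c ] c ∈ᵖ p × c ∉ ys
pick p ys ys<k with Fin.any? (λ i → ¬? (DecMembership._∈?_ ℕ._≟_ (colour p i) ys))
... | yes (i , ∉ys) = colour p i , (i , refl) , ∉ys
... | no  ⊆ys = contradiction
  (palette-⊆⇒≤ p ys λ i → decidable-stable (DecMembership._∈?_ ℕ._≟_ (colour p i) ys) (λ ∉ → ⊆ys (i , ∉)))
  (ℕ.<⇒≱ ys<k)

-- Pigeonhole: a colour of q outside p, together with the k colours of p, would give `suc k`
-- distinct indices in q.
palette-⊆⇒⊇ : ∀ {k} (p q : Palette k) → (∀ i → colour p i ∈ᵖ q) → ∀ j → colour q j ∈ᵖ p
palette-⊆⇒⊇ {k} p q p⊆q j = decidable-stable (colour q j ∈ᵖ? p) λ ∉p →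
  contradiction (Fin.injective⇒≤ (f-injective ∉p)) ℕ.1+n≰n
  where
  f : Fin (suc k) → Fin k
  f zero    = j
  f (suc i) = proj₁ (p⊆q i)
  f-injective : ¬ colour q j ∈ᵖ p → Injective _≡_ _≡_ f
  f-injective ∉p {zero}  {zero}  _  = refl
  f-injective ∉p {zero}  {suc i} eq = contradiction (i , trans (sym (proj₂ (p⊆q i))) (cong (colour q) (sym eq))) ∉p
  f-injective ∉p {suc i} {zero}  eq = contradiction (i , trans (sym (proj₂ (p⊆q i))) (cong (colour q) eq)) ∉p
  f-injective ∉p {suc i} {suc i′} eq =
    cong suc (injective p (trans (sym (proj₂ (p⊆q i))) (trans (cong (colour q) eq) (proj₂ (p⊆q i′)))))

unique-∷ʳ : ∀ {X : Set} {xs} {y : X} → Unique xs → y ∉ xs → Unique (xs ∷ʳ y)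
unique-∷ʳ xs! y∉xs = Unique.++⁺ xs! ([] ∷ []) λ { (v∈xs , here refl) → y∉xs v∈xs }

-- Plane trees and colourings of branches.

data Tree (A : Set) : Set where
  leaf : A → Tree A
  node : A → List (Tree A) → Tree A

root : Tree A → A
root (leaf a)   = a
root (node a _) = a

mutual
  lastLeaf : Tree A → A
  lastLeaf (leaf a)    = a
  lastLeaf (node a ts) = lastLeafOr a ts

  -- The label is an accumulator holding the last leaf met so far. It stays an inner label only for
  -- a childless `node`, which `Arity` excludes.
  lastLeafOr : A → List (Tree A) → A
  lastLeafOr a []       = a
  lastLeafOr a (t ∷ ts) = lastLeafOr (lastLeaf t) ts

data Arity {A : Set} (k : ℕ) : Tree A → Set where
  leaf : ∀ {a} → Arity k (leaf a)
  node : ∀ {a ts} → 2 ≤ length ts → suc (length ts) ≤ k → All (Arity k) ts → Arity k (node a ts)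

module Col {A : Set} {k : ℕ} (E R : A → Palette k) where

  -- The label a of a vertex gives the palettes E a of the edge above it and, if
  -- it is a leaf, R a of the rim edge leaving it.  In Colouring t l e r, l is
  -- the colour of the rim edge entering the first leaf, e that of the edge
  -- above the root and r that of the rim edge leaving the last leaf.

  mutual
    data Colouring : Tree A → ℕ → ℕ → ℕ → Set where
      leaf : ∀ {a l e r} → e ∈ᵖ E a → r ∈ᵖ R a → l ≢ e → e ≢ r → l ≢ r → Colouring (leaf a) l e r
      node : ∀ {a ts l e es r} → e ∈ᵖ E a → Unique (e ∷ es) → Colourings ts l es r → Colouring (node a ts) l e r

    data Colourings : List (Tree A) → ℕ → List ℕ → ℕ → Set where
      []  : ∀ {l} → Colourings [] l [] l
      _∷_ : ∀ {t ts l e es x r} → Colouring t l e x → Colourings ts x es r → Colourings (t ∷ ts) l (e ∷ es) r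

  colourings-∷ʳ : ∀ {ts t l es x e r} → Colourings ts l es x → Colouring t x e r → Colourings (ts ∷ʳ t) l (es ∷ʳ e) r
  colourings-∷ʳ []       d = d ∷ []
  colourings-∷ʳ (c ∷ cs) d = c ∷ colourings-∷ʳ cs d

  -- The tree hangs from a leaf z. The rim edge leaving z has colour l from Z, the one entering z
  -- has colour r, and the tree edge at z has colour e; these three edges meet at z.
  record RootedColouring (Z : Palette k) (t : Tree A) : Set where
    field
      {l e r}   : ℕ
      l∈Z       : l ∈ᵖ Z
      colouring : Colouring t l e r
      l≢e       : l ≢ e
      e≢r       : e ≢ r
      l≢r       : l ≢ r

-- Greedy colouring with at least four colours.

module Greedy {A : Set} {k : ℕ} (4≤k : 4 ≤ k) (E R : A → Palette k) where
  open Col E R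

  Roots : List ℕ → List (Tree A) → Set
  Roots = Pointwise (λ e t → e ∈ᵖ E (root t))

  distinctRoots : ∀ ts ys → length ts ℕ.+ length ys ≤ k →
                  ∃[ es ] Roots es ts × Unique es × All (_∉ ys) es
  distinctRoots []       ys _  = [] , [] , [] , []
  distinctRoots (t ∷ ts) ys ≤k =
    let c , c∈ , c∉ = pick (E (root t)) ys (ℕ.≤-trans (s≤s (ℕ.m≤n+m _ (length ts))) ≤k)
        es , es∈ , es! , es∉ = distinctRoots ts (c ∷ ys) (ℕ.≤-trans (ℕ.≤-reflexive (ℕ.+-suc _ _)) ≤k)
    in c ∷ es , c∈ ∷ es∈ , All.map (λ e∉ eq → e∉ (here (sym eq))) es∉ ∷ es! ,
       c∉ ∷ All.map (λ e∉ e∈ → e∉ (there e∈)) es∉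

  mutual
    -- At a leaf the two bad values are l and e. A node gives its first root edge a colour other
    -- than l and inherits the two bad values of its last branch.
    extend : ∀ t → Arity k t → ∀ {l e} → l ≢ e → e ∈ᵖ E (root t) →
             ∃[ f₁ ] ∃[ f₂ ] (∀ r → r ∈ᵖ R (lastLeaf t) → r ∉ f₁ ∷ f₂ ∷ [] → Colouring t l e r)
    extend (leaf a) leaf {l} {e} l≢e e∈ = l , e , λ r r∈ r∉ →
      leaf e∈ r∈ l≢e (λ e≡r → r∉ (there (here (sym e≡r)))) (λ l≡r → r∉ (here (sym l≡r)))
    extend (node a (t ∷ ts)) (node _ ≤k (t-ar ∷ ts-ar)) {l} {e} l≢e e∈ =
      let c , c∈ , c∉ = pick (E (root t)) (e ∷ l ∷ []) (ℕ.≤-trans (s≤s (s≤s (s≤s z≤n))) 4≤k)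
          es , es∈ , es! , es∉ = distinctRoots ts (c ∷ e ∷ []) (ℕ.≤-trans (ℕ.≤-reflexive (ℕ.+-comm (length ts) 2)) ≤k)
          f₁ , f₂ , chain = extendAll t ts t-ar ts-ar (λ l≡c → c∉ (there (here (sym l≡c)))) c∈ es∈
      in f₁ , f₂ , λ r r∈ r∉ → node e∈
        (((λ e≡c → c∉ (here (sym e≡c))) ∷ All.map (λ x∉ e≡x → x∉ (there (here (sym e≡x)))) es∉) ∷
         (All.map (λ x∉ c≡x → x∉ (here (sym c≡x))) es∉ ∷ es!)) (chain r r∈ r∉)

    -- A rim edge between consecutive branches must avoid the next root edge and the two bad values
    -- of the branch before it: three colours out of at least four.
    extendAll : ∀ t ts → Arity k t → All (Arity k) ts → ∀ {l e es} → l ≢ e → e ∈ᵖ E (root t) → Roots es ts →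
                ∃[ f₁ ] ∃[ f₂ ] (∀ r → r ∈ᵖ R (lastLeafOr (lastLeaf t) ts) → r ∉ f₁ ∷ f₂ ∷ [] →
                                 Colourings (t ∷ ts) l (e ∷ es) r)
    extendAll t [] t-ar [] l≢e e∈ [] =
      let f₁ , f₂ , ext = extend t t-ar l≢e e∈ in f₁ , f₂ , λ r r∈ r∉ → ext r r∈ r∉ ∷ []
    extendAll t (t′ ∷ ts) t-ar (t′-ar ∷ ts-ar) {es = e′ ∷ es} l≢e e∈ (e′∈ ∷ es∈) =
      let f₁ , f₂ , ext = extend t t-ar l≢e e∈
          x , x∈ , x∉ = pick (R (lastLeaf t)) (e′ ∷ f₁ ∷ f₂ ∷ []) 4≤k
          f₁′ , f₂′ , ext′ = extendAll t′ ts t′-ar ts-ar (λ x≡e′ → x∉ (here x≡e′)) e′∈ es∈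
      in f₁′ , f₂′ , λ r r∈ r∉ → ext x x∈ (λ x∈ → x∉ (there x∈)) ∷ ext′ r r∈ r∉

  -- Two nonadjacent edges can be coloured at the cost of a single colour of
  -- their common neighbour.

  saveOne : (p q s : Palette k) →
            ∃[ a ] ∃[ b ] a ∈ᵖ p × b ∈ᵖ q × (∃[ f ] (∀ c → c ∈ᵖ s → c ≢ f → c ≢ a × c ≢ b))
  saveOne p q s with Fin.any? (λ i → ¬? (colour p i ∈ᵖ? s))
  ... | yes (i , ∉s) = colour p i , colour q j , (i , refl) , (j , refl) , colour q j ,
    λ c c∈ c≢ → (λ { refl → ∉s c∈ }) , c≢
    where j = fromℕ< (ℕ.≤-trans (s≤s z≤n) 4≤k)
  ... | no ⊆s with Fin.any? (λ j → ¬? (colour q j ∈ᵖ? s))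
  ...   | yes (j , ∉s) = colour p i , colour q j , (i , refl) , (j , refl) , colour p i ,
    λ c c∈ c≢ → c≢ , (λ { refl → ∉s c∈ })
    where i = fromℕ< (ℕ.≤-trans (s≤s z≤n) 4≤k)
  ...   | no ⊆s′ = colour s i , colour s i , p∋ , q∋ , colour s i , λ c _ c≢ → c≢ , c≢
    where
    i = fromℕ< (ℕ.≤-trans (s≤s z≤n) 4≤k)
    p∋ = palette-⊆⇒⊇ p s (λ i → decidable-stable (_ ∈ᵖ? s) (λ ∉ → ⊆s (i , ∉))) i
    q∋ = palette-⊆⇒⊇ q s (λ i → decidable-stable (_ ∈ᵖ? s) (λ ∉ → ⊆s′ (i , ∉))) i

  -- The last rim edge, of colour r, meets the edges coloured l, e₁, x and e. Choosing l and e₁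
  -- first by `saveOne` makes them block a single colour f, so r has only x, e and f to avoid.
  rootedColouring : (Z : Palette k) → ∀ {a y ts} → Arity k (node a (ts ∷ʳ leaf y)) →
                    RootedColouring Z (node a (ts ∷ʳ leaf y))
  rootedColouring Z {ts = []} (node (s≤s ()) _ _)
  rootedColouring Z {a} {y} {t ∷ ts} (node _ ≤k (t-ar ∷ ts-ar)) with saveOne Z (E y) (R y)
  ... | l , e₁ , l∈ , e₁∈ , f , save =
    let e , e∈ , e∉ = pick (E a) (l ∷ e₁ ∷ []) (ℕ.≤-trans (s≤s (s≤s (s≤s z≤n))) 4≤k)
        -- The rim edge l enters the first branch, so its root edge must differ from l.
        c , c∈ , c∉ = pick (E (root t)) (l ∷ e ∷ e₁ ∷ []) 4≤k
        es , es∈ , es! , es∉ = distinctRoots ts (c ∷ e ∷ e₁ ∷ []) es-room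
        f₁ , f₂ , chain = extendAll t ts t-ar (All.++⁻ˡ ts ts-ar) (λ l≡c → c∉ (here (sym l≡c))) c∈ es∈
        -- The rim edge x enters y, where it meets e₁; f₁ and f₂ are spoiled by the branches before
        -- y.
        x , x∈ , x∉ = pick (R (lastLeafOr (lastLeaf t) ts)) (e₁ ∷ f₁ ∷ f₂ ∷ []) 4≤k
        r , r∈ , r∉ = pick (R y) (x ∷ e ∷ f ∷ []) 4≤k
        r≢l , r≢e₁ = save r r∈ (λ r≡f → r∉ (there (there (here r≡f))))
    in record
      { l∈Z = l∈
      ; colouring = node e∈
          (unique-∷ʳ {xs = e ∷ c ∷ es}
            (((λ e≡c → c∉ (there (here (sym e≡c)))) ∷ All.map (λ x∉ e≡x → x∉ (there (here (sym e≡x)))) es∉) ∷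
             (All.map (λ x∉ c≡x → x∉ (here (sym c≡x))) es∉ ∷ es!))
            λ { (here e₁≡e) → e∉ (there (here (sym e₁≡e)))
              ; (there (here e₁≡c)) → c∉ (there (there (here (sym e₁≡c))))
              ; (there (there e₁∈)) → All.lookup es∉ e₁∈ (there (there (here refl))) })
          (colourings-∷ʳ (chain x x∈ (λ x∈ → x∉ (there x∈)))
            (leaf e₁∈ r∈ (λ x≡e₁ → x∉ (here x≡e₁)) (≢-sym r≢e₁) (λ x≡r → r∉ (here (sym x≡r)))))
      ; l≢e = λ l≡e → e∉ (here (sym l≡e))
      ; e≢r = λ e≡r → r∉ (there (here (sym e≡r)))
      ; l≢r = ≢-sym r≢l
      }
    where
    es-room : length ts ℕ.+ 3 ≤ k
    es-room = ℕ.≤-trans (ℕ.≤-reflexive (trans (ℕ.+-comm (length ts) 3)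
      (cong (2 ℕ.+_) (trans (ℕ.+-comm 1 (length ts)) (sym (List.length-++ ts)))))) ≤k

-- The polynomial method with three colours.

module Cubic {A : Set} (E R : A → Palette 3) where
  open Col E R

  colours : Palette 3 → Triple
  colours p i = + colour p i

  vandermonde≢0 : ∀ {x y z} → x ≢ y → x ≢ z → y ≢ z → vandermonde (+ x) (+ y) (+ z) ≢ 0ℤ
  vandermonde≢0 {x} {y} {z} x≢y x≢z y≢z =
    *-≢0 (≢0 (≢-sym x≢y)) (*-≢0 (≢0 (≢-sym x≢z)) (≢0 (≢-sym y≢z)))
    where
    ≢0 : ∀ {m n} → m ≢ n → + m ℤ.- + n ≢ 0ℤ
    ≢0 m≢n eq = m≢n (ℤ.+-injective (ℤ.i-j≡0⇒i≡j _ _ eq))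

  vandermonde≢0⇒distinct : ∀ x y z → vandermonde (+ x) (+ y) (+ z) ≢ 0ℤ → x ≢ y × x ≢ z × y ≢ z
  vandermonde≢0⇒distinct x y z ≢0 =
    (λ { refl → ≢0 (cong (ℤ._* ((+ z ℤ.- + x) ℤ.* (+ z ℤ.- + x))) (ℤ.+-inverseʳ (+ x))) }) ,
    (λ { refl → ≢0 (trans (cong (λ v → (+ y ℤ.- + x) ℤ.* (v ℤ.* (+ x ℤ.- + y))) (ℤ.+-inverseʳ (+ x))) (ℤ.*-zeroʳ (+ y ℤ.- + x))) }) ,
    (λ { refl → ≢0 (trans (cong (λ v → (+ y ℤ.- + x) ℤ.* ((+ y ℤ.- + x) ℤ.* v)) (ℤ.+-inverseʳ (+ y)))
                   (trans (cong ((+ y ℤ.- + x) ℤ.*_) (ℤ.*-zeroʳ (+ y ℤ.- + x))) (ℤ.*-zeroʳ (+ y ℤ.- + x)))) })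

  discriminant≢0 : ∀ p → discriminant (colours p) ≢ 0ℤ
  discriminant≢0 p = vandermonde≢0 (λ eq → 0≢1 (injective p eq)) (λ eq → 0≢2 (injective p eq)) (λ eq → 1≢2 (injective p eq))
    where
    0≢1 : 0F ≢ 1F
    0≢1 ()
    0≢2 : 0F ≢ 2F
    0≢2 ()
    1≢2 : 1F ≢ 2F
    1≢2 ()

  *≢0⇒≢0ˡ : ∀ i j → i ℤ.* j ≢ 0ℤ → i ≢ 0ℤ
  *≢0⇒≢0ˡ _ j ij≢0 refl = ij≢0 refl

  *≢0⇒≢0ʳ : ∀ i j → i ℤ.* j ≢ 0ℤ → j ≢ 0ℤ
  *≢0⇒≢0ʳ i _ ij≢0 refl = ij≢0 (ℤ.*-zeroʳ i)

  -- A nonzero Vandermonde value means distinct colours, which settles leaves. At a node some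
  -- summand of `compose` is nonzero; two of its factors colour the branches and the third separates
  -- the edges at the vertex.
  extend : ∀ t → Arity 3 t → ∃[ f ] VandermondeLike f ×
           (∀ {l e r} → e ∈ᵖ E (root t) → r ∈ᵖ R (lastLeaf t) → f (+ l) (+ e) (+ r) ≢ 0ℤ → Colouring t l e r)
  extend (leaf a) leaf = vandermonde , vandermonde-like , λ {l} {e} {r} e∈ r∈ ≢0 →
    let l≢e , l≢r , e≢r = vandermonde≢0⇒distinct l e r ≢0 in leaf e∈ r∈ l≢e e≢r l≢r
  extend (node a []) (node () _ _)
  extend (node a (_ ∷ [])) (node (s≤s ()) _ _)
  extend (node a (_ ∷ _ ∷ _ ∷ _)) (node _ (s≤s (s≤s (s≤s ()))) _)
  extend (node a (t ∷ u ∷ [])) (node _ _ (t-ar ∷ u-ar ∷ [])) =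
    let f , f-like , f-col = extend t t-ar
        g , g-like , g-col = extend u u-ar
    in compose f g vandermonde ,
       compose-like p q s (discriminant≢0 (E (root t))) (discriminant≢0 (E (root u))) (discriminant≢0 (R (lastLeaf t))) f-like g-like ,
       λ {l} {e} {r} e∈ r∈ ≢0 →
         let h = λ e₁ e₂ x → f (+ l) e₁ x ℤ.* (g x e₂ (+ r) ℤ.* vandermonde (+ e) e₁ e₂)
             i , j , k , hijk≢0 = μ³-≢0 h ≢0
             e₁ = colour (E (root t)) i
             e₂ = colour (E (root u)) j
             x  = colour (R (lastLeaf t)) k
             fijk = f (+ l) (+ e₁) (+ x)
             gijk = g (+ x) (+ e₂) (+ r)
             v = vandermonde (+ e) (+ e₁) (+ e₂)
             gv≢0 = *≢0⇒≢0ʳ fijk (gijk ℤ.* v) hijk≢0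
             e≢e₁ , e≢e₂ , e₁≢e₂ = vandermonde≢0⇒distinct e e₁ e₂ (*≢0⇒≢0ʳ gijk v gv≢0)
         in node e∈ ((e≢e₁ ∷ e≢e₂ ∷ []) ∷ (e₁≢e₂ ∷ []) ∷ [] ∷ [])
              (f-col (i , refl) (k , refl) (*≢0⇒≢0ˡ fijk (gijk ℤ.* v) hijk≢0) ∷
               g-col (j , refl) r∈ (*≢0⇒≢0ˡ gijk v gv≢0) ∷ [])
    where
    p q s : Triple
    p = colours (E (root t))
    q = colours (E (root u))
    s = colours (R (lastLeaf t))
    open Elimination p q s

  -- The sum runs over the palettes of the three edges at the root leaf. A nonzero summand makes
  -- these edges distinct and extends into the tree.
  rootedColouring : (Z : Palette 3) → ∀ t → Arity 3 t → RootedColouring Z t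
  rootedColouring Z t t-ar =
    let f , f-like , f-col = extend t t-ar
        i , j , k , ijk≢0 = μ³-≢0 (λ l e r → f l e r ℤ.* vandermonde l e r)
          (close-like (colours Z) (colours (E (root t))) (colours (R (lastLeaf t)))
            (discriminant≢0 Z) (discriminant≢0 (E (root t))) (discriminant≢0 (R (lastLeaf t))) f-like)
        l = colour Z i
        e = colour (E (root t)) j
        r = colour (R (lastLeaf t)) k
        fijk = f (+ l) (+ e) (+ r)
        v = vandermonde (+ l) (+ e) (+ r)
        l≢e , l≢r , e≢r = vandermonde≢0⇒distinct l e r (*≢0⇒≢0ʳ fijk v ijk≢0)
    in record
      { l∈Z = i , refl
      ; colouring = f-col (j , refl) (k , refl) (*≢0⇒≢0ˡ fijk v ijk≢0)
      ; l≢e = l≢e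
      ; e≢r = e≢r
      ; l≢r = l≢r
      }
    where open Elimination (colours Z) (colours (E (root t))) (colours (R (lastLeaf t)))

rootedColouring : ∀ {A k} (E R : A → Palette k) (Z : Palette k) → 3 ≤ k → ∀ {a y ts} →
                  Arity k (node a (ts ∷ʳ leaf y)) → Col.RootedColouring E R Z (node a (ts ∷ʳ leaf y))
rootedColouring {k = k} E R Z 3≤k t-ar with ℕ.m≤n⇒m<n∨m≡n 3≤k
... | inj₁ 4≤k  = Greedy.rootedColouring 4≤k E R Z t-ar
... | inj₂ refl = Cubic.rootedColouring E R Z _ t-ar

-- From inductive colourings to colour functions on labels.

mutual
  labels : Tree A → List A
  labels (leaf a)    = a ∷ []
  labels (node a ts) = a ∷ labelsAll ts

  labelsAll : List (Tree A) → List A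
  labelsAll []       = []
  labelsAll (t ∷ ts) = labels t ++ labelsAll ts

unique-++⁻ : ∀ (xs : List A) {ys} → Unique (xs ++ ys) →
             Unique xs × Unique ys × (∀ {v} → v ∈ xs → v ∉ ys)
unique-++⁻ []       u        = [] , u , λ ()
unique-++⁻ (x ∷ xs) (x∉ ∷ u) =
  let xs! , ys! , disjoint = unique-++⁻ xs u
  in All.++⁻ˡ xs x∉ ∷ xs! , ys! , λ
    { (here refl) v∈ys → All.lookup (All.++⁻ʳ xs x∉) v∈ys refl
    ; (there v∈xs) v∈ys → disjoint v∈xs v∈ys }

module Decode {A : Set} (_≟_ : DecidableEquality A) {k} (E R : A → Palette k) where
  open Col E R
  open DecMembership _≟_ using (_∈?_)

  -- Valid c d: the edge above the vertex a has colour c a, and the rim edge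
  -- leaving the leaf a has colour d a.

  mutual
    data Valid (c d : A → ℕ) : Tree A → ℕ → ℕ → ℕ → Set where
      leaf : ∀ {a l e r} → e ≡ c a → r ≡ d a → e ∈ᵖ E a → r ∈ᵖ R a → l ≢ e → e ≢ r → l ≢ r →
             Valid c d (leaf a) l e r
      node : ∀ {a ts l e es r} → e ≡ c a → e ∈ᵖ E a → Unique (e ∷ es) → Valids c d ts l es r →
             Valid c d (node a ts) l e r

    data Valids (c d : A → ℕ) : List (Tree A) → ℕ → List ℕ → ℕ → Set where
      []  : ∀ {l} → Valids c d [] l [] l
      _∷_ : ∀ {t ts l e es x r} → Valid c d t l e x → Valids c d ts x es r → Valids c d (t ∷ ts) l (e ∷ es) r

  mutual
    valid-cong : ∀ {c d c′ d′ t l e r} → (∀ {a} → a ∈ labels t → c a ≡ c′ a) → (∀ {a} → a ∈ labels t → d a ≡ d′ a) →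
                 Valid c d t l e r → Valid c′ d′ t l e r
    valid-cong c≗ d≗ (leaf e≡ r≡ e∈ r∈ l≢e e≢r l≢r) =
      leaf (trans e≡ (c≗ (here refl))) (trans r≡ (d≗ (here refl))) e∈ r∈ l≢e e≢r l≢r
    valid-cong c≗ d≗ (node e≡ e∈ es! vs) =
      node (trans e≡ (c≗ (here refl))) e∈ es! (valids-cong (λ a∈ → c≗ (there a∈)) (λ a∈ → d≗ (there a∈)) vs)

    valids-cong : ∀ {c d c′ d′ ts l es r} → (∀ {a} → a ∈ labelsAll ts → c a ≡ c′ a) →
                  (∀ {a} → a ∈ labelsAll ts → d a ≡ d′ a) → Valids c d ts l es r → Valids c′ d′ ts l es r
    valids-cong c≗ d≗ [] = []
    valids-cong {ts = t ∷ _} c≗ d≗ (v ∷ vs) =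
      valid-cong (λ a∈ → c≗ (∈-++⁺ˡ a∈)) (λ a∈ → d≗ (∈-++⁺ˡ a∈)) v ∷
      valids-cong (λ a∈ → c≗ (∈-++⁺ʳ (labels t) a∈)) (λ a∈ → d≗ (∈-++⁺ʳ (labels t) a∈)) vs

  override : List A → (A → ℕ) → (A → ℕ) → A → ℕ
  override xs f g a with a ∈? xs
  ... | yes _ = f a
  ... | no  _ = g a

  override-∈ : ∀ {xs a} f g → a ∈ xs → override xs f g a ≡ f a
  override-∈ {xs} {a} f g a∈ with a ∈? xs
  ... | yes _  = refl
  ... | no  a∉ = contradiction a∈ a∉

  override-∉ : ∀ {xs a} f g → a ∉ xs → override xs f g a ≡ g a
  override-∉ {xs} {a} f g a∉ with a ∈? xs
  ... | yes a∈ = contradiction a∈ a∉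
  ... | no  _  = refl

  mutual
    -- Distinct labels allow the functions found for separate branches to be merged without
    -- overwriting each other.
    decode : ∀ {t l e r} → Unique (labels t) → Colouring t l e r → ∃[ c ] ∃[ d ] Valid c d t l e r
    decode {l = l} {e} {r} _ (leaf e∈ r∈ l≢e e≢r l≢r) = (λ _ → e) , (λ _ → r) , leaf refl refl e∈ r∈ l≢e e≢r l≢r
    decode {node a ts} {e = e} (a∉ ∷ ts!) (node e∈ es! cs) =
      let c , d , vs = decodeAll ts! cs
          ∉a : ∀ {b} → b ∈ labelsAll ts → b ∉ a ∷ []
          ∉a b∈ = λ { (here refl) → All.lookup a∉ b∈ refl }
      in override (a ∷ []) (λ _ → e) c , d ,
         node (sym (override-∈ {a ∷ []} (λ _ → e) c (here refl))) e∈ es!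
           (valids-cong (λ b∈ → sym (override-∉ (λ _ → e) c (∉a b∈))) (λ _ → refl) vs)

    decodeAll : ∀ {ts l es r} → Unique (labelsAll ts) → Colourings ts l es r → ∃[ c ] ∃[ d ] Valids c d ts l es r
    -- There is no label to colour, so the value 0 is arbitrary.
    decodeAll _ [] = (λ _ → 0) , (λ _ → 0) , []
    decodeAll {t ∷ ts} u (x ∷ xs) =
      let t! , ts! , disjoint = unique-++⁻ (labels t) u
          c , d , v = decode t! x
          c′ , d′ , vs = decodeAll ts! xs
      in override (labels t) c c′ , override (labels t) d d′ ,
         (valid-cong (λ a∈ → sym (override-∈ c c′ a∈)) (λ a∈ → sym (override-∈ d d′ a∈)) v ∷
          valids-cong (λ a∈ → sym (override-∉ c c′ (λ a∈t → disjoint a∈t a∈)))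
                      (λ a∈ → sym (override-∉ d d′ (λ a∈t → disjoint a∈t a∈))) vs)

-- Embedded trees

unique-lookup-injective : ∀ {xs : List A} → Unique xs → Injective _≡_ _≡_ (lookup xs)
unique-lookup-injective (_ ∷ _)   {zero}  {zero}  _  = refl
unique-lookup-injective (x∉ ∷ _)  {zero}  {suc j} eq = contradiction eq (All.lookup x∉ (∈-lookup j))
unique-lookup-injective (x∉ ∷ _)  {suc i} {zero}  eq = contradiction (sym eq) (All.lookup x∉ (∈-lookup i))
unique-lookup-injective (_ ∷ xs!) {suc i} {suc j} eq = cong suc (unique-lookup-injective xs! eq)

unique-⊆⇒length≤ : ∀ {xs ys : List A} → Unique xs → (∀ {x} → x ∈ xs → x ∈ ys) → length xs ≤ length ys
unique-⊆⇒length≤ {xs = xs} {ys} xs! ⊆ys = Fin.injective⇒≤ {f = λ i → Any.index (⊆ys (∈-lookup i))} λ {i} {j} eq →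
  unique-lookup-injective xs! (trans (Any.lookup-index (⊆ys (∈-lookup i)))
    (trans (cong (lookup ys) eq) (sym (Any.lookup-index (⊆ys (∈-lookup j))))))

unique-map-injective : ∀ (f : A → B) {xs x y} → Unique (map f xs) → x ∈ xs → y ∈ xs → f x ≡ f y → x ≡ y
unique-map-injective f (_ ∷ _)   (here refl) (here refl) _  = refl
unique-map-injective f (x∉ ∷ _)  (here refl) (there y∈)  eq = contradiction eq (All.lookup x∉ (∈-map⁺ f y∈))
unique-map-injective f (x∉ ∷ _)  (there x∈)  (here refl) eq = contradiction (sym eq) (All.lookup x∉ (∈-map⁺ f x∈))
unique-map-injective f (_ ∷ xs!) (there x∈)  (there y∈)  eq = unique-map-injective f xs! x∈ y∈ eq

-- Neighbourhoods as lists, and degrees.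

elements : (Fin n → Bool) → List (Fin n)
elements {zero}  f = []
elements {suc n} f with f zero
... | true  = zero ∷ map suc (elements (f ∘ suc))
... | false = map suc (elements (f ∘ suc))

length-elements : (f : Fin n → Bool) → length (elements f) ≡ ∣ Vec.tabulate f ∣
length-elements {zero}  f = refl
length-elements {suc n} f with f zero
... | true  = cong suc (trans (List.length-map suc (elements (f ∘ suc))) (length-elements (f ∘ suc)))
... | false = trans (List.length-map suc (elements (f ∘ suc))) (length-elements (f ∘ suc))

∈-elements⁺ : (f : Fin n → Bool) → ∀ {i} → T (f i) → i ∈ elements f
∈-elements⁺ f {zero} fi with f zero
... | true = here refl
∈-elements⁺ f {suc i} fi with f zero
... | true  = there (∈-map⁺ suc (∈-elements⁺ (f ∘ suc) fi))
... | false = ∈-map⁺ suc (∈-elements⁺ (f ∘ suc) fi)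

∈-elements⁻ : (f : Fin n → Bool) → ∀ {i} → i ∈ elements f → T (f i)
∈-elements⁻ {suc n} f {i} i∈ with f zero in eq
∈-elements⁻ {suc n} f (here refl) | true = subst T (sym eq) _
∈-elements⁻ {suc n} f (there i∈)  | true with ∈-map⁻ suc i∈
... | j , j∈ , refl = ∈-elements⁻ (f ∘ suc) j∈
∈-elements⁻ {suc n} f i∈ | false with ∈-map⁻ suc i∈
... | j , j∈ , refl = ∈-elements⁻ (f ∘ suc) j∈

elements-unique : (f : Fin n → Bool) → Unique (elements f)
elements-unique {zero}  f = []
elements-unique {suc n} f with f zero
... | true  = All.map⁺ (All.tabulate λ _ ()) ∷ Unique.map⁺ Fin.suc-injective (elements-unique (f ∘ suc))
... | false = Unique.map⁺ Fin.suc-injective (elements-unique (f ∘ suc))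

module Degree (G : Graph n) where
  open Graph G hiding (sym)

  length≤degree : ∀ {v xs} → Unique xs → (∀ {w} → w ∈ xs → Adj v w) → length xs ≤ degree v
  length≤degree {v} xs! xs~v = ℕ.≤-trans
    (unique-⊆⇒length≤ xs! (λ w∈ → ∈-elements⁺ (adj v) (xs~v w∈)))
    (ℕ.≤-reflexive (length-elements (adj v)))

  degree≤length : ∀ {v xs} → (∀ {w} → Adj v w → w ∈ xs) → degree v ≤ length xs
  degree≤length {v} ~v⊆xs = ℕ.≤-trans (ℕ.≤-reflexive (sym (length-elements (adj v))))
    (unique-⊆⇒length≤ (elements-unique (adj v)) (λ w∈ → ~v⊆xs (∈-elements⁻ (adj v) w∈)))

  leaf-neighbour-unique : ∀ {v x y} → Leaf v → Adj v x → Adj v y → x ≡ y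
  leaf-neighbour-unique {v} {x} {y} v-leaf v~x v~y = decidable-stable (x Fin.≟ y) λ x≢y →
    contradiction (subst (2 ≤_) v-leaf (length≤degree {xs = x ∷ y ∷ []} ((x≢y ∷ []) ∷ [] ∷ [])
      λ { (here refl) → v~x ; (there (here refl)) → v~y })) λ { (s≤s ()) }

  Leaf? : ∀ v → Dec (Leaf v)
  Leaf? v = degree v ℕ.≟ 1

  adjacent-≢ : ∀ {u v} → Adj u v → u ≢ v
  adjacent-≢ u~v refl = irrefl _ u~v

-- Walks in acyclic graphs.

module Walks (G : Graph n) (acyclic : Graph.Acyclic G) where
  open Graph G hiding (sym)
  open Degree G

  data Path : Fin n → Fin n → List (Fin n) → Set where
    []  : ∀ {x} → Path x x []
    _∷_ : ∀ {x y z xs} → Adj x y → Path y z xs → Path x z (y ∷ xs)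

  data WalkAvoiding (v : Fin n) : Fin n → Fin n → Set where
    nil  : ∀ {x} → x ≢ v → WalkAvoiding v x x
    cons : ∀ {x y z} → x ≢ v → Adj x y → WalkAvoiding v y z → WalkAvoiding v x z

  walk-source : ∀ {v x y} → WalkAvoiding v x y → x ≢ v
  walk-source (nil x≢v)      = x≢v
  walk-source (cons x≢v _ _) = x≢v

  walk-target : ∀ {v x y} → WalkAvoiding v x y → y ≢ v
  walk-target (nil x≢v)    = x≢v
  walk-target (cons _ _ p) = walk-target p

  walk-trans : ∀ {v x y z} → WalkAvoiding v x y → WalkAvoiding v y z → WalkAvoiding v x z
  walk-trans (nil _)          q = q
  walk-trans (cons x≢v x~y p) q = cons x≢v x~y (walk-trans p q)

  walk-sym : ∀ {v x y} → WalkAvoiding v x y → WalkAvoiding v y x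
  walk-sym (nil x≢v) = nil x≢v
  walk-sym (cons x≢v x~y p) =
    walk-trans (walk-sym p) (cons (walk-source p) (Graph.sym G _ _ x~y) (nil x≢v))

  SimplePath : Fin n → Fin n → Fin n → Set
  SimplePath v x y = ∃[ xs ] Path x y xs × Unique (x ∷ xs) × All (_≢ v) (x ∷ xs)

  path-suffix : ∀ {v x y z xs} → Path z y xs → Unique (z ∷ xs) → All (_≢ v) (z ∷ xs) → x ∈ z ∷ xs → SimplePath v x y
  path-suffix p xs! ≢v (here refl) = _ , p , xs! , ≢v
  path-suffix (_ ∷ p) (_ ∷ xs!) (_ ∷ ≢v) (there x∈) = path-suffix p xs! ≢v x∈

  -- Loop erasure: if x recurs on the simplified remainder, the path is cut back to the suffix
  -- starting there.
  simplify : ∀ {v x y} → WalkAvoiding v x y → SimplePath v x y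
  simplify (nil x≢v) = [] , [] , [] ∷ [] , x≢v ∷ []
  simplify {x = x} (cons {y = y} x≢v x~y w) with simplify w
  ... | xs , p , xs! , ≢v with DecMembership._∈?_ Fin._≟_ x (y ∷ xs)
  ...   | yes x∈ = path-suffix p xs! ≢v x∈
  ...   | no  x∉ = y ∷ xs , x~y ∷ p , All.tabulate (λ { z∈ refl → x∉ z∈ }) ∷ xs! , x≢v ∷ ≢v

  path-linked : ∀ {x y z xs} → Path x y xs → Adj y z → Linked Adj ((x ∷ xs) ∷ʳ z)
  path-linked []        y~z = y~z ∷ [-]
  path-linked (x~y ∷ p) y~z = x~y ∷ path-linked p y~z

  -- After loop erasure the walk would close up through v to a cycle.
  no-detour : ∀ {v x y} → Adj v x → Adj v y → x ≢ y → ¬ WalkAvoiding v x y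
  no-detour {v} {x} {y} v~x v~y x≢y w with simplify w
  ... | .[] , [] , _ , _ = x≢y refl
  ... | .(_ ∷ _) , p@(_ ∷ _) , xs! , ≢v =
    acyclic v x _ _ (All.map (λ z≢v v≡z → z≢v (sym v≡z)) ≢v ∷ xs!)
            (v~x ∷ path-linked p (Graph.sym G _ _ v~y))

  -- Reaching w from u without passing v would be a detour between two neighbours of v.
  avoid-neighbour : ∀ {v u w y} → Adj v u → Adj v w → u ≢ w → WalkAvoiding v u y → WalkAvoiding w u y
  avoid-neighbour {v} {u} {w} v~u v~w u≢w walk = go (nil (walk-source walk)) walk
    where
    ≢w : ∀ {x} → WalkAvoiding v u x → x ≢ w
    ≢w p refl = no-detour v~u v~w u≢w p
    -- The first argument is the part already walked; it shows that the current vertex is not w.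
    go : ∀ {x y} → WalkAvoiding v u x → WalkAvoiding v x y → WalkAvoiding w x y
    go p (nil _) = nil (≢w p)
    go p (cons x≢v x~y q) = cons (≢w p) x~y (go (walk-trans p (cons x≢v x~y (nil (walk-source q)))) q)

iterate : (A → A) → ℕ → A → A
iterate = Endo._^_ _

iterate-shift : ∀ (f : A → A) k x → iterate f k (f x) ≡ f (iterate f k x)
iterate-shift f zero    x = refl
iterate-shift f (suc k) x = cong f (iterate-shift f k x)

iterate-+ : ∀ (f : A → A) j k x → iterate f (j ℕ.+ k) x ≡ iterate f j (iterate f k x)
iterate-+ f zero    k x = refl
iterate-+ f (suc j) k x = cong f (iterate-+ f j k x)

iterate-fixed : ∀ (f : A → A) j k x → iterate f k x ≡ x → iterate f (j ℕ.* k) x ≡ x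
iterate-fixed f zero    k x eq = refl
iterate-fixed f (suc j) k x eq = trans (iterate-+ f k (j ℕ.* k) x) (trans (cong (iterate f k) (iterate-fixed f j k x eq)) eq)

-- Rooted subtrees of an embedded tree.

module Embedded (G : Graph n) (acyclic : Graph.Acyclic G) (ρ : Rotation G) where
  open Graph G hiding (sym)
  open Rotation ρ
  open Degree G
  open Walks G acyclic

  adj-sym : ∀ {u v} → Adj u v → Adj v u
  adj-sym = Graph.sym G _ _

  -- After one step the orbits of x and y agree. Both points are periodic, and a common multiple of
  -- the two periods returns each to itself at the same moment.
  next-injective : ∀ {v x y} → Adj v x → Adj v y → next v x ≡ next v y → x ≡ y
  next-injective {v} {x} {y} v~x v~y eq with cyclic v x y v~x v~y | cyclic v y x v~y v~x
  ... | zero  , x≡y | _ = x≡y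
  ... | suc _ , _ | zero , y≡x = sym y≡x
  ... | suc j , xʲ≡y | suc i , yⁱ≡x =
    trans (sym (iterate-fixed f (suc j) (suc i) x xⁱ≡x)) (trans same
      (trans (cong (λ m → iterate f m y) (ℕ.*-comm (suc j) (suc i))) (iterate-fixed f (suc i) (suc j) y yʲ≡y)))
    where
    f = next v
    merge : ∀ k → iterate f (suc k) x ≡ iterate f (suc k) y
    merge zero    = eq
    merge (suc k) = cong f (merge k)
    xⁱ≡x : iterate f (suc i) x ≡ x
    xⁱ≡x = trans (merge i) yⁱ≡x
    yʲ≡y : iterate f (suc j) y ≡ y
    yʲ≡y = trans (sym (merge j)) xʲ≡y
    same : iterate f (suc j ℕ.* suc i) x ≡ iterate f (suc j ℕ.* suc i) y
    same = merge (i ℕ.+ j ℕ.* suc i)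

  -- Sub u v is the part of the tree on the side of v of the edge uv; the
  -- children of v are next v u, next v (next v u), … up to u.

  mutual
    data Sub (u v : Fin n) : Set where
      leaf : Leaf v → Sub u v
      node : ¬ Leaf v → Forest u v (next v u) → Sub u v

    data Forest (u v w : Fin n) : Set where
      done : w ≡ u → Forest u v w
      step : w ≢ u → Adj v w → Sub v w → Forest u v (next v w) → Forest u v w

  -- The recursion measure k is a number of turns that bring w to u.
  buildForest : ∀ {u v} → (∀ w → Adj v w → w ≢ u → Sub v w) → ∀ k w → Adj v w → iterate (next v) k w ≡ u → Forest u v w
  buildForest sub zero w v~w w≡u = done w≡u
  buildForest {u} {v} sub (suc k) w v~w eq with w Fin.≟ u
  ... | yes w≡u = done w≡u
  ... | no  w≢u = step w≢u v~w (sub w v~w w≢u)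
    (buildForest sub k (next v w) (closed v w v~w) (trans (iterate-shift (next v) k w) eq))

  -- The list `ys` holds distinct vertices already passed, all reachable from u without v. With v
  -- added there are at most n of them, so the fuel cannot run out at an inner vertex.
  build′ : ∀ fuel {u v} → Adj u v → ∀ ys → Unique ys → (∀ {y} → y ∈ ys → WalkAvoiding v u y) →
           n ≤ length ys ℕ.+ fuel → Sub u v
  build′ fuel {u} {v} u~v ys ys! walks n≤ with Leaf? v
  ... | yes v-leaf = leaf v-leaf
  build′ zero {u} {v} u~v ys ys! walks n≤ | no _ =
    contradiction (ℕ.≤-trans (s≤s (subst (n ≤_) (ℕ.+-identityʳ _) n≤))
      (ℕ.≤-trans (unique-⊆⇒length≤ {xs = v ∷ ys} {ys = allFin n}
         (All.tabulate (λ { y∈ refl → walk-target (walks y∈) refl }) ∷ ys!) (λ _ → ∈-allFin _))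
         (ℕ.≤-reflexive (List.length-tabulate id)))) ℕ.1+n≰n
  build′ (suc fuel) {u} {v} u~v ys ys! walks n≤ | no v-inner =
    let k , eq = cyclic v (next v u) u (closed v u (adj-sym u~v)) (adj-sym u~v)
    in node v-inner (buildForest child k (next v u) (closed v u (adj-sym u~v)) eq)
    where
    child : ∀ w → Adj v w → w ≢ u → Sub v w
    child w v~w w≢u = build′ fuel v~w (v ∷ ys)
      (All.tabulate (λ { y∈ refl → walk-target (walks y∈) refl }) ∷ ys!)
      (λ { (here refl) → nil (adjacent-≢ v~w)
         ; (there y∈) → cons (adjacent-≢ v~w) (adj-sym u~v)
             (avoid-neighbour (adj-sym u~v) v~w (≢-sym w≢u) (walks y∈)) })
      (ℕ.≤-trans n≤ (ℕ.≤-reflexive (ℕ.+-suc _ _)))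

  build : ∀ {u v} → Adj u v → Sub u v
  build {u} {v} u~v = build′ n u~v (u ∷ []) ([] ∷ []) (λ { (here refl) → nil (adjacent-≢ u~v) }) (ℕ.m≤n+m n 1)

  -- In a rooted subtree the dart (u , v) is the vertex v entered from its parent u. It serves as
  -- key for the tree edge above v and for the rim edge leaving a leaf v.
  Dart : Set
  Dart = Fin n × Fin n

  mutual
    tree : ∀ {u v} → Sub u v → Tree Dart
    tree {u} {v} (leaf _)   = leaf (u , v)
    tree {u} {v} (node _ F) = node (u , v) (trees F)

    trees : ∀ {u v w} → Forest u v w → List (Tree Dart)
    trees (done _)       = []
    trees (step _ _ S F) = tree S ∷ trees F

  children : ∀ {u v w} → Forest u v w → List (Fin n)
  children (done _)           = []
  children {w = w} (step _ _ _ F) = w ∷ children F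

  darts : ∀ {u v} → Sub u v → List Dart
  darts S = labels (tree S)

  dartsAll : ∀ {u v w} → Forest u v w → List Dart
  dartsAll F = labelsAll (trees F)

  root-tree : ∀ {u v} (S : Sub u v) → root (tree S) ≡ (u , v)
  root-tree (leaf _)   = refl
  root-tree (node _ _) = refl

  roots-trees : ∀ {u v w} (F : Forest u v w) → map root (trees F) ≡ map (v ,_) (children F)
  roots-trees (done _)       = refl
  roots-trees (step _ _ S F) = cong₂ _∷_ (root-tree S) (roots-trees F)

  root-dart : ∀ {u v} (S : Sub u v) → (u , v) ∈ darts S
  root-dart (leaf _)   = here refl
  root-dart (node _ _) = here refl

  child-dart : ∀ {u v w x} (F : Forest u v w) → x ∈ children F → (v , x) ∈ dartsAll F
  child-dart (step _ _ S F) (here refl) = ∈-++⁺ˡ (root-dart S)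
  child-dart (step _ _ S F) (there x∈)  = ∈-++⁺ʳ (darts S) (child-dart F x∈)

  child-adjacent : ∀ {u v w x} (F : Forest u v w) → x ∈ children F → Adj v x
  child-adjacent (step _ v~w _ _) (here refl) = v~w
  child-adjacent (step _ _ _ F)   (there x∈)  = child-adjacent F x∈

  child-≢ : ∀ {u v w x} (F : Forest u v w) → x ∈ children F → x ≢ u
  child-≢ (step w≢u _ _ _) (here refl) = w≢u
  child-≢ (step _ _ _ F)   (there x∈)  = child-≢ F x∈

  mutual
    dart-walk : ∀ {u v a b} → Adj u v → (S : Sub u v) → (a , b) ∈ darts S → WalkAvoiding u v b
    dart-walk u~v (leaf _)   (here refl) = nil (≢-sym (adjacent-≢ u~v))
    dart-walk u~v (node _ F) (here refl) = nil (≢-sym (adjacent-≢ u~v))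
    dart-walk u~v (node _ F) (there ab∈) =
      let x , x∈ , p = dart-walkAll F ab∈
      in cons (≢-sym (adjacent-≢ u~v)) (child-adjacent F x∈)
           (avoid-neighbour (child-adjacent F x∈) (adj-sym u~v) (child-≢ F x∈) p)

    dart-walkAll : ∀ {u v w a b} (F : Forest u v w) → (a , b) ∈ dartsAll F → ∃[ x ] x ∈ children F × WalkAvoiding v x b
    dart-walkAll {w = w} (step _ v~w S F) ab∈ with ∈-++⁻ (darts S) ab∈
    ... | inj₁ ab∈S = w , here refl , dart-walk v~w S ab∈S
    ... | inj₂ ab∈F = let x , x∈ , p = dart-walkAll F ab∈F in x , there x∈ , p

  size-unique : ∀ {u v w} (F F′ : Forest u v w) → length (children F) ≡ length (children F′)
  size-unique (done _)         (done _)         = refl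
  size-unique (done w≡u)       (step w≢u _ _ _) = contradiction w≡u w≢u
  size-unique (step w≢u _ _ _) (done w≡u)       = contradiction w≡u w≢u
  size-unique (step _ _ _ F)   (step _ _ _ F′)  = cong suc (size-unique F F′)

  subforest : ∀ {u v w x} (F : Forest u v w) → x ∈ children F →
              Σ (Forest u v x) λ F′ → length (children F′) ≤ length (children F)
  subforest F@(step _ _ _ _) (here refl) = F , ℕ.≤-refl
  subforest (step _ _ _ F)   (there x∈)  = let F′ , ≤F = subforest F x∈ in F′ , ℕ.m≤n⇒m≤1+n ≤F

  -- If w came up again, the suffix starting there would be as long as the whole forest starting at
  -- w, since `next` determines its length.
  child-fresh : ∀ {u v w} w≢u v~w (S : Sub v w) (F : Forest u v (next v w)) → w ∉ children F
  child-fresh w≢u v~w S F w∈ =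
    let F′ , ≤F = subforest F w∈
    in ℕ.1+n≰n (subst (_≤ length (children F)) (size-unique F′ (step w≢u v~w S F)) ≤F)

  children-unique : ∀ {u v w} (F : Forest u v w) → Unique (children F)
  children-unique (done _) = []
  children-unique (step w≢u v~w S F) = All.tabulate (λ { x∈ refl → child-fresh w≢u v~w S F x∈ }) ∷ children-unique F

  mutual
    -- A vertex shared by two sibling branches would join two neighbours of v by a walk avoiding v.
    targets-unique : ∀ {u v} → Adj u v → (S : Sub u v) → Unique (map proj₂ (darts S))
    targets-unique u~v (leaf _)   = [] ∷ []
    targets-unique {u} {v} u~v (node _ F) = All.tabulate fresh ∷ targets-uniqueAll F
      where
      fresh : ∀ {x} → x ∈ map proj₂ (dartsAll F) → v ≢ x
      fresh x∈ refl with ∈-map⁻ proj₂ x∈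
      ... | (a , b) , ab∈ , refl = walk-target (proj₂ (proj₂ (dart-walkAll F ab∈))) refl

    targets-uniqueAll : ∀ {u v w} (F : Forest u v w) → Unique (map proj₂ (dartsAll F))
    targets-uniqueAll (done _) = []
    targets-uniqueAll {u} {v} {w} (step w≢u v~w S F) =
      subst Unique (sym (List.map-++ proj₂ (darts S) (dartsAll F)))
        (Unique.++⁺ (targets-unique v~w S) (targets-uniqueAll F) disjoint)
      where
      disjoint : ∀ {x} → ¬ (x ∈ map proj₂ (darts S) × x ∈ map proj₂ (dartsAll F))
      disjoint (x∈S , x∈F) with ∈-map⁻ proj₂ x∈S | ∈-map⁻ proj₂ x∈F
      ... | (a , b) , ab∈S , refl | (a′ , .b) , ab∈F , refl =
        let y , y∈ , p = dart-walkAll F ab∈F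
        in no-detour v~w (child-adjacent F y∈) (λ w≡y → child-fresh w≢u v~w S F (subst (_∈ children F) (sym w≡y) y∈))
             (walk-trans (dart-walk v~w S ab∈S) (walk-sym p))

  dart-unique : ∀ {u v a a′ b} → Adj u v → (S : Sub u v) → (a , b) ∈ darts S → (a′ , b) ∈ darts S → a ≡ a′
  dart-unique u~v S ab∈ a′b∈ =
    cong proj₁ (unique-map-injective proj₂ (targets-unique u~v S) ab∈ a′b∈ refl)

  mutual
    dart-adjacent : ∀ {u v a b} → Adj u v → (S : Sub u v) → (a , b) ∈ darts S → Adj a b
    dart-adjacent u~v (leaf _)   (here refl) = u~v
    dart-adjacent u~v (node _ F) (here refl) = u~v
    dart-adjacent u~v (node _ F) (there ab∈) = dart-adjacentAll F ab∈

    dart-adjacentAll : ∀ {u v w a b} (F : Forest u v w) → (a , b) ∈ dartsAll F → Adj a b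
    dart-adjacentAll (step _ v~w S F) ab∈ with ∈-++⁻ (darts S) ab∈
    ... | inj₁ ab∈S = dart-adjacent v~w S ab∈S
    ... | inj₂ ab∈F = dart-adjacentAll F ab∈F

  children-start : ∀ {u v w} (F : Forest u v w) → w ≡ u ⊎ w ∈ children F
  children-start (done w≡u)     = inj₁ w≡u
  children-start (step _ _ _ _) = inj₂ (here refl)

  children-next : ∀ {u v w x} (F : Forest u v w) → x ∈ children F → next v x ≡ u ⊎ next v x ∈ children F
  children-next (step _ _ _ F) (here refl) with children-start F
  ... | inj₁ ≡u = inj₁ ≡u
  ... | inj₂ ∈F = inj₂ (there ∈F)
  children-next (step _ _ _ F) (there x∈) with children-next F x∈
  ... | inj₁ ≡u = inj₁ ≡u
  ... | inj₂ ∈F = inj₂ (there ∈F)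

  -- The orbit of u under `next v` contains every neighbour of v, and each point of it is u or an
  -- enumerated child.
  children-complete : ∀ {u v x} → Adj u v → (F : Forest u v (next v u)) → Adj v x → x ≢ u → x ∈ children F
  children-complete {u} {v} {x} u~v F v~x x≢u with cyclic v u x (adj-sym u~v) v~x
  ... | k , eq with orbit k
    where
    orbit : ∀ k → iterate (next v) k u ≡ u ⊎ iterate (next v) k u ∈ children F
    orbit zero = inj₁ refl
    orbit (suc k) with orbit k
    ... | inj₁ ≡u rewrite ≡u = children-start F
    ... | inj₂ ∈F = children-next F ∈F
  ...   | inj₁ ≡u = contradiction (trans (sym eq) ≡u) x≢u
  ...   | inj₂ ∈F = subst (_∈ children F) eq ∈F

  degree-node : ∀ {u v} → Adj u v → (F : Forest u v (next v u)) → degree v ≡ suc (length (children F))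
  degree-node {u} {v} u~v F = ℕ.≤-antisym (degree≤length {xs = u ∷ children F} complete) (length≤degree u∷children! sound)
    where
    complete : ∀ {w} → Adj v w → w ∈ u ∷ children F
    complete {w} v~w with w Fin.≟ u
    ... | yes refl = here refl
    ... | no  w≢u  = there (children-complete u~v F v~w w≢u)
    sound : ∀ {w} → w ∈ u ∷ children F → Adj v w
    sound (here refl) = adj-sym u~v
    sound (there w∈)  = child-adjacent F w∈
    u∷children! : Unique (u ∷ children F)
    u∷children! = All.tabulate (λ { w∈ refl → child-≢ F w∈ refl }) ∷ children-unique F

  length-trees : ∀ {u v w} (F : Forest u v w) → length (trees F) ≡ length (children F)
  length-trees (done _)       = refl
  length-trees (step _ _ _ F) = cong suc (length-trees F)

  mutual
    dart-neighbour : ∀ {u v a b x} → Adj u v → (S : Sub u v) → (a , b) ∈ darts S → Adj b x → x ≢ a → (b , x) ∈ darts S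
    dart-neighbour u~v (leaf v-leaf) (here refl) v~x x≢u =
      contradiction (leaf-neighbour-unique v-leaf v~x (adj-sym u~v)) x≢u
    dart-neighbour u~v (node _ F) (here refl) v~x x≢u = there (child-dart F (children-complete u~v F v~x x≢u))
    dart-neighbour u~v (node _ F) (there ab∈) b~x x≢a = there (dart-neighbourAll F ab∈ b~x x≢a)

    dart-neighbourAll : ∀ {u v w a b x} (F : Forest u v w) → (a , b) ∈ dartsAll F → Adj b x → x ≢ a → (b , x) ∈ dartsAll F
    dart-neighbourAll (step _ v~w S F) ab∈ b~x x≢a with ∈-++⁻ (darts S) ab∈
    ... | inj₁ ab∈S = ∈-++⁺ˡ (dart-neighbour v~w S ab∈S b~x x≢a)
    ... | inj₂ ab∈F = ∈-++⁺ʳ (darts S) (dart-neighbourAll F ab∈F b~x x≢a)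

  mutual
    dart-parent : ∀ {u v a b} → (S : Sub u v) → (a , b) ∈ darts S →
                  (a ≡ u × b ≡ v) ⊎ (∃[ x ] (x , a) ∈ darts S × b ≢ x)
    dart-parent (leaf _)   (here refl) = inj₁ (refl , refl)
    dart-parent (node _ _) (here refl) = inj₁ (refl , refl)
    dart-parent {u} {v} (node _ F) (there ab∈) with dart-parentAll F ab∈
    ... | inj₁ (refl , b≢u)    = inj₂ (u , here refl , b≢u)
    ... | inj₂ (x , xa∈ , b≢x) = inj₂ (x , there xa∈ , b≢x)

    dart-parentAll : ∀ {u v w a b} → (F : Forest u v w) → (a , b) ∈ dartsAll F →
                     (a ≡ v × b ≢ u) ⊎ (∃[ x ] (x , a) ∈ dartsAll F × b ≢ x)
    dart-parentAll (step w≢u _ S F) ab∈ with ∈-++⁻ (darts S) ab∈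
    dart-parentAll (step w≢u _ S F) ab∈ | inj₁ ab∈S with dart-parent S ab∈S
    ... | inj₁ (refl , refl)   = inj₁ (refl , w≢u)
    ... | inj₂ (x , xa∈ , b≢x) = inj₂ (x , ∈-++⁺ˡ xa∈ , b≢x)
    dart-parentAll (step w≢u _ S F) ab∈ | inj₂ ab∈F with dart-parentAll F ab∈F
    ... | inj₁ a≡v             = inj₁ a≡v
    ... | inj₂ (x , xa∈ , b≢x) = inj₂ (x , ∈-++⁺ʳ (darts S) xa∈ , b≢x)

  -- Boundary walks and the cyclic order of the leaves.

  first : ∀ {u v} → Adj u v → Sub u v → ∃[ ℓ ] FirstLeaf G ρ u v ℓ
  first {v = v} _ (leaf v-leaf) = v , here v-leaf
  first u~v (node v-inner F@(done _)) = contradiction (degree-node u~v F) v-inner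
  first u~v (node v-inner (step _ v~w S _)) = let ℓ , p = first v~w S in ℓ , turn v-inner p

  firstLeaf-functional : ∀ {u v ℓ ℓ′} → FirstLeaf G ρ u v ℓ → FirstLeaf G ρ u v ℓ′ → ℓ ≡ ℓ′
  firstLeaf-functional (here _)         (here _)         = refl
  firstLeaf-functional (here v-leaf)    (turn v-inner _) = contradiction v-leaf v-inner
  firstLeaf-functional (turn v-inner _) (here v-leaf)    = contradiction v-leaf v-inner
  firstLeaf-functional (turn _ p)       (turn _ q)       = firstLeaf-functional p q

  nextLeaf-functional : ∀ {ℓ a b} → NextLeaf G ρ ℓ a → NextLeaf G ρ ℓ b → a ≡ b
  nextLeaf-functional (ℓ-leaf , p , ℓ~p , ℓ→a) (_ , q , ℓ~q , ℓ→b)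
    with refl ← leaf-neighbour-unique ℓ-leaf ℓ~p ℓ~q = firstLeaf-functional ℓ→a ℓ→b

  firstLeaf-leaf : ∀ {u v ℓ} → FirstLeaf G ρ u v ℓ → Leaf ℓ
  firstLeaf-leaf (here v-leaf) = v-leaf
  firstLeaf-leaf (turn _ p)    = firstLeaf-leaf p

  -- The walk of FirstLeaf, extended at its end, so that two walks entering
  -- the same leaf can be compared backwards.

  data FaceWalk (u v : Fin n) : Fin n → Fin n → Set where
    start : FaceWalk u v u v
    _▷_   : ∀ {x y} → FaceWalk u v x y → ¬ Leaf y → FaceWalk u v y (next y x)

  faceWalk : ∀ {u v x y ℓ} → FaceWalk u v x y → FirstLeaf G ρ x y ℓ → ∃[ q ] FaceWalk u v q ℓ
  faceWalk w (here _)         = _ , w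
  faceWalk w (turn y-inner p) = faceWalk (w ▷ y-inner) p

  faceWalk-adjacent : ∀ {u v x y} → Adj u v → FaceWalk u v x y → Adj x y
  faceWalk-adjacent u~v start   = u~v
  faceWalk-adjacent u~v (w ▷ _) = closed _ _ (adj-sym (faceWalk-adjacent u~v w))

  -- Backwards the walk is deterministic because `next` is injective on neighbours. Only its first
  -- dart leaves a leaf, so two retraced walks reach their starts together.
  faceWalk-source : ∀ {a u b v x y z y′} → Leaf a → Leaf b → Adj a u → Adj b v →
                    FaceWalk a u x y → FaceWalk b v z y′ → x ≡ z → y ≡ y′ → a ≡ b
  faceWalk-source a-leaf b-leaf a~u b~v start start refl _ = refl
  faceWalk-source a-leaf b-leaf a~u b~v start (_ ▷ inner) refl _ = contradiction a-leaf inner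
  faceWalk-source a-leaf b-leaf a~u b~v (_ ▷ inner) start refl _ = contradiction b-leaf inner
  faceWalk-source a-leaf b-leaf a~u b~v (w ▷ _) (w′ ▷ _) refl eq =
    faceWalk-source a-leaf b-leaf a~u b~v w w′
      (next-injective (adj-sym (faceWalk-adjacent a~u w)) (adj-sym (faceWalk-adjacent b~v w′)) eq) refl

  nextLeaf-injective : ∀ {a b ℓ} → NextLeaf G ρ a ℓ → NextLeaf G ρ b ℓ → a ≡ b
  nextLeaf-injective (a-leaf , p , a~p , a→ℓ) (b-leaf , q , b~q , b→ℓ) =
    let x , w = faceWalk start a→ℓ
        y , w′ = faceWalk start b→ℓ
    in faceWalk-source a-leaf b-leaf a~p b~q w w′
         (leaf-neighbour-unique (firstLeaf-leaf a→ℓ) (adj-sym (faceWalk-adjacent a~p w)) (adj-sym (faceWalk-adjacent b~q w′))) refl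

  -- Arities, and two successive leaves with a common neighbour.

  module _ {k} (degree≢2 : ∀ v → degree v ≢ 2) (degree≤k : ∀ v → degree v ≤ k) where

    children≥2 : ∀ {u v} → Adj u v → ¬ Leaf v → (F : Forest u v (next v u)) → 2 ≤ length (children F)
    children≥2 {v = v} u~v v-inner F with length (children F) | degree-node u~v F
    ... | 0           | eq = contradiction eq v-inner
    ... | 1           | eq = contradiction eq (degree≢2 v)
    ... | suc (suc _) | _  = s≤s (s≤s z≤n)

    mutual
      arity : ∀ {u v} → Adj u v → (S : Sub u v) → Arity k (tree S)
      arity u~v (leaf _) = leaf
      arity {v = v} u~v (node v-inner F) =
        node (subst (2 ≤_) (sym (length-trees F)) (children≥2 u~v v-inner F))
             (subst (_≤ k) (trans (degree-node u~v F) (cong suc (sym (length-trees F)))) (degree≤k v))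
             (arityAll F)

      arityAll : ∀ {u v w} (F : Forest u v w) → All (Arity k) (trees F)
      arityAll (done _)         = []
      arityAll (step _ v~w S F) = arity v~w S ∷ arityAll F

    record Cherry : Set where
      field
        {centre left right} : Fin n
        inner      : ¬ Leaf centre
        leftLeaf   : Leaf left
        rightLeaf  : Leaf right
        leftEdge   : Adj centre left
        rightEdge  : Adj centre right
        different  : left ≢ right
        successive : next centre left ≡ right

    -- As long as one of the first two children is inner, descend into it. The subtree is finite, so
    -- the first two children are eventually both leaves.
    cherry : ∀ {u v} → Adj u v → ¬ Leaf v → Sub u v → Cherry
    cherry u~v v-inner (leaf v-leaf) = contradiction v-leaf v-inner
    cherry {u} {v} u~v v-inner (node _ F) with F | children≥2 u~v v-inner F
    ... | done _ | ()
    ... | step _ _ _ (done _) | s≤s ()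
    ... | step w≢u v~w S@(node w-inner _) _ | _ = cherry v~w w-inner S
    ... | step _ _ (leaf _) (step _ v~x S@(node x-inner _) _) | _ = cherry v~x x-inner S
    ... | step w≢u v~w S@(leaf w-leaf) F′@(step _ v~x (leaf x-leaf) _) | _ = record
      { inner = v-inner
      ; leftLeaf = w-leaf
      ; rightLeaf = x-leaf
      ; leftEdge = v~w
      ; rightEdge = v~x
      ; different = λ eq → child-fresh w≢u v~w S F′ (here eq)
      ; successive = refl
      }

  trees-∷ʳ : ∀ {u v w y} (F : Forest u v w) → Adj v u → y ∈ children F → Leaf y → next v y ≡ u →
             ∃[ ts ] trees F ≡ ts ∷ʳ leaf (v , y)
  trees-∷ʳ (step _ _ (leaf _) (done _)) v~u (here refl) y-leaf eq = [] , refl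
  trees-∷ʳ (step _ _ (node y-inner _) _) v~u (here refl) y-leaf eq = contradiction y-leaf y-inner
  trees-∷ʳ (step _ _ _ (step ≢u _ _ _)) v~u (here refl) y-leaf eq = contradiction eq ≢u
  trees-∷ʳ (step _ _ S F) v~u (there y∈) y-leaf eq =
    let ts , eq′ = trees-∷ʳ F v~u y∈ y-leaf eq in tree S ∷ ts , cong (tree S ∷_) eq′

  _≟ᵈ_ : (x y : Dart) → Dec (x ≡ y)
  _≟ᵈ_ = ≡-dec Fin._≟_ Fin._≟_

  -- Colour functions read on the embedded tree.

  module _ {k} (E R : Dart → Palette k) where
    open Decode _≟ᵈ_ E R

    module _ {c d : Dart → ℕ} where

      mutual
        valid-edge : ∀ {u v l e r a b} (S : Sub u v) → Valid c d (tree S) l e r → (a , b) ∈ darts S →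
                     c (a , b) ∈ᵖ E (a , b)
        valid-edge (leaf _)   (leaf refl _ e∈ _ _ _ _) (here refl) = e∈
        valid-edge (node _ F) (node refl e∈ _ _)       (here refl) = e∈
        valid-edge (node _ F) (node _ _ _ vs)          (there ab∈) = valid-edgeAll F vs ab∈

        valid-edgeAll : ∀ {u v w l es r a b} (F : Forest u v w) → Valids c d (trees F) l es r → (a , b) ∈ dartsAll F →
                        c (a , b) ∈ᵖ E (a , b)
        valid-edgeAll (step _ _ S F) (v ∷ vs) ab∈ with ∈-++⁻ (darts S) ab∈
        ... | inj₁ ab∈S = valid-edge S v ab∈S
        ... | inj₂ ab∈F = valid-edgeAll F vs ab∈F

      -- Properness at the vertex b: the list covers its neighbours other than the parent a, and all
      -- tree edges at b receive distinct colours.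
      ProperStar : Dart → Set
      ProperStar (a , b) = ∃[ xs ] Unique (c (a , b) ∷ map (λ x → c (b , x)) xs) × (∀ {x} → Adj b x → x ≢ a → x ∈ xs)

      valids-colours : ∀ {u v w l es r} (F : Forest u v w) → Valids c d (trees F) l es r →
                       es ≡ map (λ x → c (v , x)) (children F)
      valids-colours (done _) [] = refl
      valids-colours (step _ _ (leaf _) F)   (leaf refl _ _ _ _ _ _ ∷ vs) = cong (_ ∷_) (valids-colours F vs)
      valids-colours (step _ _ (node _ _) F) (node refl _ _ _ ∷ vs)       = cong (_ ∷_) (valids-colours F vs)

      mutual
        valid-star : ∀ {u v l e r a b} → Adj u v → (S : Sub u v) → Valid c d (tree S) l e r → (a , b) ∈ darts S → ProperStar (a , b)
        valid-star u~v (leaf v-leaf) _ (here refl) =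
          [] , [] ∷ [] , λ v~x x≢u → contradiction (leaf-neighbour-unique v-leaf v~x (adj-sym u~v)) x≢u
        valid-star u~v (node _ F) (node refl _ es! vs) (here refl) =
          children F , subst (λ es → Unique (_ ∷ es)) (valids-colours F vs) es! , children-complete u~v F
        valid-star u~v (node _ F) (node _ _ _ vs) (there ab∈) = valid-starAll F vs ab∈

        valid-starAll : ∀ {u v w l es r a b} (F : Forest u v w) → Valids c d (trees F) l es r → (a , b) ∈ dartsAll F → ProperStar (a , b)
        valid-starAll (step _ v~w S F) (v ∷ vs) ab∈ with ∈-++⁻ (darts S) ab∈
        ... | inj₁ ab∈S = valid-star v~w S v ab∈S
        ... | inj₂ ab∈F = valid-starAll F vs ab∈F

      -- The rim edge of colour x leaves the leaf end, and the boundary walk from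
      -- there passes from u to v.

      record Arrives (x : ℕ) (u v : Fin n) : Set where
        field
          {centre end} : Fin n
          end-leaf : Leaf end
          end~centre : Adj end centre
          colour≡ : x ≡ d (centre , end)
          first⇒ : ∀ {ℓ} → FirstLeaf G ρ u v ℓ → FirstLeaf G ρ end centre ℓ

      arrives-turn : ∀ {x u v} → ¬ Leaf v → Arrives x u v → Arrives x v (next v u)
      arrives-turn v-inner arr = record
        { end-leaf = end-leaf ; end~centre = end~centre ; colour≡ = colour≡
        ; first⇒ = λ p → first⇒ (turn v-inner p) }
        where open Arrives arr

      record GoodLeaf (a b : Fin n) : Set where
        field
          {centre end} : Fin n
          end-leaf   : Leaf end
          end~centre : Adj end centre
          nextLeaf   : NextLeaf G ρ end b
          in≢edge    : d (centre , end) ≢ c (a , b)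
          in≢out     : d (centre , end) ≢ d (a , b)
          edge≢out   : c (a , b) ≢ d (a , b)
          out∈       : d (a , b) ∈ᵖ R (a , b)

      mutual
        -- The boundary walk enters a branch along uv and leaves it along vu. Carrying `Arrives`
        -- along this walk identifies, at each leaf, the rim edge that comes in.
        valid-leaves : ∀ {u v l e r} → Adj u v → (S : Sub u v) → Valid c d (tree S) l e r → Arrives l u v →
                       Arrives r v u × (∀ {a b} → (a , b) ∈ darts S → Leaf b → GoodLeaf a b)
        valid-leaves u~v (leaf v-leaf) (leaf refl refl _ r∈ l≢e e≢r l≢r) arr =
          record { end-leaf = v-leaf ; end~centre = adj-sym u~v ; colour≡ = refl ; first⇒ = id } ,
          λ { (here refl) _ → record
              { end-leaf = end-leaf
              ; end~centre = end~centre
              ; nextLeaf = end-leaf , _ , end~centre , first⇒ (here v-leaf)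
              ; in≢edge = λ eq → l≢e (trans colour≡ eq)
              ; in≢out = λ eq → l≢r (trans colour≡ eq)
              ; edge≢out = e≢r
              ; out∈ = r∈
              } }
          where open Arrives arr
        valid-leaves u~v (node v-inner F) (node _ _ _ vs) arr =
          let arr′ , good = valid-leavesAll v-inner F vs (arrives-turn v-inner arr)
          in arr′ , λ { (here refl) b-leaf → contradiction b-leaf v-inner
                      ; (there ab∈) b-leaf → good ab∈ b-leaf }

        valid-leavesAll : ∀ {u v w l es r} → ¬ Leaf v → (F : Forest u v w) → Valids c d (trees F) l es r → Arrives l v w →
                          Arrives r v u × (∀ {a b} → (a , b) ∈ dartsAll F → Leaf b → GoodLeaf a b)
        valid-leavesAll v-inner (done refl) [] arr = arr , λ ()
        valid-leavesAll {v = v} v-inner (step _ v~w S F) (x ∷ vs) arr =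
          let arr′ , good = valid-leaves v~w S x arr
              arr″ , good′ = valid-leavesAll v-inner F vs (arrives-turn v-inner arr′)
          in arr″ , λ ab∈ b-leaf → [ (λ ab∈S → good ab∈S b-leaf) , (λ ab∈F → good′ ab∈F b-leaf) ]′ (∈-++⁻ (darts S) ab∈)

-- Halin graphs

module Edges (G : Graph n) where
  open Graph G hiding (sym)

  edge-≡ : ∀ {s t s<t s<t′ s~t s~t′} → edge s t s<t s~t ≡ edge s t s<t′ s~t′
  edge-≡ = cong₂ (edge _ _) (Fin.<-irrelevant _ _) (T-irrelevant _ _)

  mkEdge : ∀ u v → Adj u v → Edge
  mkEdge u v u~v with Fin.<-cmp u v
  ... | tri< u<v _ _ = edge u v u<v u~v
  ... | tri≈ _ refl _ = contradiction u~v (irrefl u)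
  ... | tri> _ _ v<u = edge v u v<u (Graph.sym G u v u~v)

  mkEdge-edge : ∀ {s t s<t} (s~t s~t′ : Adj s t) → mkEdge s t s~t ≡ edge s t s<t s~t′
  mkEdge-edge {s} {t} {s<t} s~t s~t′ with Fin.<-cmp s t
  ... | tri< _ _ _ = edge-≡
  ... | tri≈ s≮t _ _ = contradiction s<t s≮t
  ... | tri> s≮t _ _ = contradiction s<t s≮t

  mkEdge-edge′ : ∀ {s t s<t} (t~s : Adj t s) (s~t : Adj s t) → mkEdge t s t~s ≡ edge s t s<t s~t
  mkEdge-edge′ {s} {t} {s<t} t~s s~t with Fin.<-cmp t s
  ... | tri< _ _ s≮t = contradiction s<t s≮t
  ... | tri≈ _ _ s≮t = contradiction s<t s≮t
  ... | tri> _ _ _ = edge-≡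

  ∈-mkEdge⁺ : ∀ {u v} (u~v : Adj u v) → u ∈ᵉ mkEdge u v u~v × v ∈ᵉ mkEdge u v u~v
  ∈-mkEdge⁺ {u} {v} u~v with Fin.<-cmp u v
  ... | tri< _ _ _    = inj₁ refl , inj₂ refl
  ... | tri≈ _ refl _ = contradiction u~v (irrefl u)
  ... | tri> _ _ _    = inj₂ refl , inj₁ refl

  ∈-mkEdge⁻ : ∀ {u v w} (u~v : Adj u v) → w ∈ᵉ mkEdge u v u~v → w ≡ u ⊎ w ≡ v
  ∈-mkEdge⁻ {u} {v} u~v w∈ with Fin.<-cmp u v
  ... | tri< _ _ _ = w∈
  ... | tri≈ _ refl _ = contradiction u~v (irrefl u)
  ∈-mkEdge⁻ u~v (inj₁ w≡v) | tri> _ _ _ = inj₂ w≡v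
  ∈-mkEdge⁻ u~v (inj₂ w≡u) | tri> _ _ _ = inj₁ w≡u

  -- The lower bound by the maximum degree.

  degree≤maxDegree : ∀ v → degree v ≤ maxDegree
  degree≤maxDegree v = All.lookup (xs≤max 0 (map degree (allFin n))) (∈-map⁺ degree (∈-allFin v))

  choosable⇒maxDegree≤ : ∀ j → EdgeChoosable G j → maxDegree ≤ j
  choosable⇒maxDegree≤ j choosable = max≤v⁺ {xs = map degree (allFin n)} z≤n
    (All.map⁺ (All.tabulate {xs = allFin n} λ {v} _ → degree≤j v))
    where
    open ListEdgeColouring (choosable (λ _ c → c < j) λ _ → toℕ , Fin.toℕ-injective , Fin.toℕ<n)
    degree≤j : ∀ v → degree v ≤ j
    degree≤j v = subst (_≤ j) (length-elements (adj v)) (Fin.injective⇒≤ {f = f} f-injective)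
      where
      neighbour : ∀ i → Adj v (lookup (elements (adj v)) i)
      neighbour i = ∈-elements⁻ (adj v) (∈-lookup i)
      e : ∀ i → Edge
      e i = mkEdge v _ (neighbour i)
      f : Fin (length (elements (adj v))) → Fin j
      f i = fromℕ< (fromList (e i))
      e≢ : ∀ {i i′} → i ≢ i′ → e i ≢ e i′
      e≢ {i} {i′} i≢i′ eq with ∈-mkEdge⁻ (neighbour i) (subst (_ ∈ᵉ_) (sym eq) (proj₂ (∈-mkEdge⁺ (neighbour i′))))
      ... | inj₁ ≡v = irrefl v (subst (Adj v) ≡v (neighbour i′))
      ... | inj₂ ≡  = i≢i′ (unique-lookup-injective (elements-unique (adj v)) (sym ≡))
      f-injective : ∀ {i i′} → f i ≡ f i′ → i ≡ i′
      f-injective {i} {i′} eq with i Fin.≟ i′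
      ... | yes i≡i′ = i≡i′
      ... | no  i≢i′ = contradiction
        (trans (sym (Fin.toℕ-fromℕ< (fromList (e i)))) (trans (cong toℕ eq) (Fin.toℕ-fromℕ< (fromList (e i′)))))
        (proper (e i) (e i′) (e≢ i≢i′) (v , proj₁ (∈-mkEdge⁺ (neighbour i)) , proj₁ (∈-mkEdge⁺ (neighbour i′))))

-- If two adjacent vertices are both leaves, nothing else can be reached from them, and a third
-- vertex contradicts connectedness.
connected⇒inner : (T : Graph n) → 3 ≤ n → Graph.Connected T → ∃[ u ] ∃[ v ] Graph.Adj T u v × ¬ Graph.Leaf T v
connected⇒inner T (s≤s (s≤s (s≤s _))) connected with connected zero (suc zero)
... | _◅_ {j = p} 0~p _ with Degree.Leaf? T zero | Degree.Leaf? T p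
...   | no inner | _ = p , zero , Graph.sym T _ _ 0~p , inner
...   | _ | no inner = zero , p , 0~p , inner
...   | yes 0-leaf | yes p-leaf with reach (connected zero (suc zero)) (inj₁ refl) | reach (connected zero (suc (suc zero))) (inj₁ refl)
  where
  open Degree T
  reach : ∀ {x y} → Star (Graph.Adj T) x y → x ≡ zero ⊎ x ≡ p → y ≡ zero ⊎ y ≡ p
  reach ε x∈ = x∈
  reach (x~y ◅ s) (inj₁ refl) = reach s (inj₂ (leaf-neighbour-unique 0-leaf x~y 0~p))
  reach (x~y ◅ s) (inj₂ refl) = reach s (inj₁ (leaf-neighbour-unique p-leaf x~y (Graph.sym T _ _ 0~p)))
...     | inj₂ refl | inj₂ ()
...     | inj₁ () | _
...     | _ | inj₁ ()

-- The upper bound: palettes from lists, and rooting at a leaf.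

module Halin (G : Graph n) (halin : IsHalin G) (L : ListAssignment G)
             (large : ∀ e → HasAtLeast (Graph.maxDegree G) (L e)) where
  open IsHalin halin renaming (tree to T′; embedding to ρ)
  open Edges G using (mkEdge; mkEdge-edge; mkEdge-edge′; degree≤maxDegree)
  open Graph T′ using (Adj; adj; degree; Leaf)
  open Graph G using (edge; module Edge)
  open Degree T′
  open Walks T′ (proj₂ isTree) using (walk-target)
  open Embedded T′ (proj₂ isTree) ρ
  open Rotation ρ

  k : ℕ
  k = Graph.maxDegree G

  degree≤k : ∀ v → degree v ≤ k
  degree≤k v = ℕ.≤-trans (subst (_≤ Graph.degree G v) (length-elements (adj v))
    (Degree.length≤degree G (elements-unique (adj v)) (λ w∈ → Equivalence.from (adjacency _ _) (inj₁ (∈-elements⁻ (adj v) w∈)))))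
    (degree≤maxDegree v)

  palette : Fin n → Fin n → Palette k
  palette u v with T? (Graph.adj G u v)
  ... | yes u~v = record { colour = proj₁ (large (mkEdge u v u~v)) ; injective = proj₁ (proj₂ (large (mkEdge u v u~v))) }
  -- A placeholder that makes `palette` total; only palettes of adjacent pairs are compared with the
  -- lists.
  ... | no  _   = record { colour = toℕ ; injective = Fin.toℕ-injective }

  palette⊆L : ∀ {u v c} (u~v : Graph.Adj G u v) → c ∈ᵖ palette u v → L (mkEdge u v u~v) c
  palette⊆L {u} {v} u~v c∈ with T? (Graph.adj G u v)
  palette⊆L {u} {v} u~v (i , refl) | yes u~v′ =
    subst (λ a → L (mkEdge u v a) _) (T-irrelevant u~v′ u~v) (proj₂ (proj₂ (large (mkEdge u v u~v′))) i)
  ... | no u≁v = contradiction u~v u≁v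

  -- Total, as `successor` is, so that every dart has a rim palette. The default v is returned only
  -- for an isolated vertex.
  neighbour : Fin n → Fin n
  neighbour v with Fin.any? (λ w → T? (adj v w))
  ... | yes (w , _) = w
  ... | no  _       = v

  neighbour-adjacent : ∀ {v w} → Adj v w → Adj v (neighbour v)
  neighbour-adjacent {v} v~w with Fin.any? (λ w → T? (adj v w))
  ... | yes (_ , v~w′) = v~w′
  ... | no  isolated   = contradiction (_ , v~w) isolated

  neighbour-≡ : ∀ {v w} → Leaf v → Adj v w → neighbour v ≡ w
  neighbour-≡ v-leaf v~w = leaf-neighbour-unique v-leaf (neighbour-adjacent v~w) v~w

  successor : Fin n → Fin n
  successor v with T? (adj v (neighbour v))
  ... | yes v~p = proj₁ (first v~p (build v~p))
  ... | no  _   = v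

  successor-nextLeaf : ∀ {v w} → Leaf v → Adj v w → NextLeaf T′ ρ v (successor v)
  successor-nextLeaf {v} v-leaf v~w with T? (adj v (neighbour v))
  ... | yes v~p = v-leaf , neighbour v , v~p , proj₂ (first v~p (build v~p))
  ... | no  v≁p = contradiction (neighbour-adjacent v~w) v≁p

  edgePalette rimPalette : Dart → Palette k
  edgePalette (u , v) = palette u v
  rimPalette  (_ , v) = palette v (successor v)

  open Col edgePalette rimPalette
  open Decode _≟ᵈ_ edgePalette rimPalette

  rootedColouring′ : ∀ Z t {a b ts} → 3 ≤ k → t ≡ node a (ts ∷ʳ leaf b) → Arity k t → RootedColouring Z t
  rootedColouring′ Z t 3≤k refl t-ar = rootedColouring edgePalette rimPalette Z 3≤k t-ar

  module Rooted {y p z} (inner : ¬ Leaf p) (y-leaf : Leaf y) (z-leaf : Leaf z) (p~y : Adj p y) (p~z : Adj p z)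
                (y≢z : y ≢ z) (successive : next p y ≡ z) (S : Sub z p) where
    z~p : Adj z p
    z~p = adj-sym p~z

    3≤k : Sub z p → 3 ≤ k
    3≤k (leaf p-leaf) = contradiction p-leaf inner
    3≤k (node _ F) = ℕ.≤-trans (s≤s (children≥2 noDegreeTwo degree≤k z~p inner F))
      (subst (_≤ k) (degree-node z~p F) (degree≤k p))

    tree-∷ʳ : (S : Sub z p) → ∃[ ts ] tree S ≡ node (z , p) (ts ∷ʳ leaf (p , y))
    tree-∷ʳ (leaf p-leaf) = contradiction p-leaf inner
    tree-∷ʳ (node _ F) = let ts , eq = trees-∷ʳ F p~z (children-complete z~p F p~y y≢z) y-leaf successive
                         in ts , cong (node (z , p)) eq

    target-≢ : ∀ {a} → (a , z) ∉ darts S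
    target-≢ az∈ = walk-target (dart-walk z~p S az∈) refl

    -- The vertices of S together with z are closed under adjacency: a neighbour of a vertex of S is
    -- its parent or one of its children.
    reach : ∀ {x y} → Star Adj x y → x ≡ z ⊎ (∃[ u ] (u , x) ∈ darts S) → y ≡ z ⊎ (∃[ u ] (u , y) ∈ darts S)
    reach ε x∈ = x∈
    reach (x~y ◅ s) (inj₁ refl) with refl ← leaf-neighbour-unique z-leaf x~y z~p = reach s (inj₂ (z , root-dart S))
    reach (_◅_ {j = y} x~y s) (inj₂ (u , ux∈)) with y Fin.≟ u
    ... | no  y≢u = reach s (inj₂ (_ , dart-neighbour z~p S ux∈ x~y y≢u))
    ... | yes refl with dart-parent S ux∈
    ...   | inj₁ (y≡z , _)       = reach s (inj₁ y≡z)
    ...   | inj₂ (x′ , x′y∈ , _) = reach s (inj₂ (x′ , x′y∈))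

    incoming : ∀ v → v ≡ z ⊎ (∃[ u ] (u , v) ∈ darts S)
    incoming v = reach (proj₁ isTree z v) (inj₁ refl)

    dart-complete : ∀ {a b} → Adj a b → (a , b) ∈ darts S ⊎ (b , a) ∈ darts S
    dart-complete {a} {b} a~b with incoming a
    ... | inj₁ refl with refl ← leaf-neighbour-unique z-leaf a~b z~p = inj₁ (root-dart S)
    ... | inj₂ (u , ua∈) with b Fin.≟ u
    ...   | yes refl = inj₂ ua∈
    ...   | no  b≢u  = inj₁ (dart-neighbour z~p S ua∈ a~b b≢u)

    rooted : RootedColouring (palette z (successor z)) (tree S)
    rooted = rootedColouring′ _ (tree S) (3≤k S) (proj₂ (tree-∷ʳ S)) (arity noDegreeTwo degree≤k z~p S)

    valid-root : ∀ {c d u v l e r} (S : Sub u v) → Valid c d (tree S) l e r → e ≡ c (u , v)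
    valid-root (leaf _)   (leaf refl _ _ _ _ _ _) = refl
    valid-root (node _ _) (node refl _ _ _)       = refl

    -- The rim edge that leaves z gets its colour at the key (p , z), which is
    -- not a dart of S.

    decoded : ∀ {l e r} → Colouring (tree S) l e r → ∃[ c ] ∃[ d ] Valid c d (tree S) l e r × d (p , z) ≡ l
    decoded {l} colouring with decode (Unique.map⁻ (targets-unique z~p S)) colouring
    ... | c , d , v = c , override ((p , z) ∷ []) (λ _ → l) d ,
      valid-cong (λ _ → refl) (λ a∈ → sym (override-∉ {(p , z) ∷ []} (λ _ → l) d λ { (here refl) → target-≢ a∈ })) v ,
      override-∈ {(p , z) ∷ []} (λ _ → l) d (here refl)

    -- Assembling the edge colouring of the Halin graph.

    module Colours {l e r : ℕ} (l∈Z : l ∈ᵖ palette z (successor z)) (l≢e : l ≢ e) (e≢r : e ≢ r) (l≢r : l ≢ r)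
                   (c d : Dart → ℕ) (valid : Valid c d (tree S) l e r) (d-z : d (p , z) ≡ l) where

      -- The only neighbour of a leaf in S is its parent, so this reads the key under which d stores
      -- the rim edge; at z it reads the extra key (p , z).
      rim : Fin n → ℕ
      rim v = d (neighbour v , v)

      rim-≡ : ∀ {u v} → Leaf v → Adj v u → rim v ≡ d (u , v)
      rim-≡ {v = v} v-leaf v~u = cong (λ w → d (w , v)) (neighbour-≡ v-leaf v~u)

      rim-z : rim z ≡ l
      rim-z = trans (rim-≡ z-leaf z~p) d-z

      data TreeColour (v w : Fin n) : ℕ → Set where
        down : (v , w) ∈ darts S → TreeColour v w (c (v , w))
        up   : (w , v) ∈ darts S → TreeColour v w (c (w , v))

      record RimColours (v : Fin n) : Set where
        field
          {predecessor} : Fin n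
          nextLeaf  : NextLeaf T′ ρ predecessor v
          in≢out    : rim predecessor ≢ rim v
          in≢edge   : ∀ {w x} → TreeColour v w x → rim predecessor ≢ x
          edge≢out  : ∀ {w x} → TreeColour v w x → x ≢ rim v
          out∈      : rim v ∈ᵖ palette v (successor v)

      leaves : Arrives edgePalette rimPalette {c} {d} r p z ×
               (∀ {a b} → (a , b) ∈ darts S → Leaf b → GoodLeaf edgePalette rimPalette {c} {d} a b)
      leaves = valid-leaves edgePalette rimPalette z~p S valid
        (record { end-leaf = z-leaf ; end~centre = z~p ; colour≡ = sym d-z ; first⇒ = id })

      treeColour-z : ∀ {w x} → TreeColour z w x → x ≡ e
      treeColour-z (up wz∈)   = contradiction wz∈ target-≢
      treeColour-z (down zw∈) with refl ← leaf-neighbour-unique z-leaf (dart-adjacent z~p S zw∈) z~p =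
        sym (valid-root S valid)

      treeColour-leaf : ∀ {u v w x} → (u , v) ∈ darts S → Leaf v → TreeColour v w x → x ≡ c (u , v)
      treeColour-leaf uv∈ v-leaf (up wv∈) = cong (λ a → c (a , _)) (dart-unique z~p S wv∈ uv∈)
      treeColour-leaf uv∈ v-leaf (down vw∈) with dart-parent S vw∈
      ... | inj₁ (refl , _) = contradiction uv∈ target-≢
      ... | inj₂ (u′ , u′v∈ , w≢u′) = contradiction
        (leaf-neighbour-unique v-leaf (dart-adjacent z~p S vw∈) (adj-sym (dart-adjacent z~p S u′v∈))) w≢u′

      rimColours : ∀ v → Leaf v → RimColours v
      rimColours v v-leaf with incoming v
      -- The boundary walk around S returns from p to z, so the rim edge entering z is the one
      -- coloured r.
      ... | inj₁ refl = record
        { nextLeaf = end-leaf , _ , end~centre , first⇒ (here z-leaf)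
        ; in≢out   = λ eq → l≢r (sym (trans in≡r (trans eq rim-z)))
        ; in≢edge  = λ tc eq → e≢r (sym (trans in≡r (trans eq (treeColour-z tc))))
        ; edge≢out = λ tc eq → l≢e (sym (trans (sym (treeColour-z tc)) (trans eq rim-z)))
        ; out∈     = subst (_∈ᵖ palette z (successor z)) (sym rim-z) l∈Z
        }
        where
        open Arrives (proj₁ leaves)
        in≡r : r ≡ rim end
        in≡r = trans colour≡ (sym (rim-≡ end-leaf end~centre))
      ... | inj₂ (u , uv∈) = record
        { nextLeaf = good.nextLeaf
        ; in≢out   = λ eq → good.in≢out (trans (sym in≡) (trans eq out≡))
        ; in≢edge  = λ tc eq → good.in≢edge (trans (sym in≡) (trans eq (treeColour-leaf uv∈ v-leaf tc)))
        ; edge≢out = λ tc eq → good.edge≢out (trans (sym (treeColour-leaf uv∈ v-leaf tc)) (trans eq out≡))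
        ; out∈     = subst (_∈ᵖ palette v (successor v)) (sym out≡) good.out∈
        }
        where
        module good = GoodLeaf (proj₂ leaves uv∈ v-leaf)
        in≡ : rim good.end ≡ d (good.centre , good.end)
        in≡ = rim-≡ good.end-leaf good.end~centre
        out≡ : rim v ≡ d (u , v)
        out≡ = rim-≡ v-leaf (adj-sym (dart-adjacent z~p S uv∈))

      star : ∀ {u v} → (u , v) ∈ darts S → ∃[ xs ] Unique (c (u , v) ∷ map (λ x → c (v , x)) xs) ×
                                                (∀ {x} → Adj v x → x ≢ u → x ∈ xs)
      star = valid-star edgePalette rimPalette z~p S valid

      up≢down : ∀ {a v b} → (a , v) ∈ darts S → (v , b) ∈ darts S → b ≢ a → c (a , v) ≢ c (v , b)
      up≢down av∈ vb∈ b≢a with star av∈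
      ... | xs , c∉ ∷ _ , complete = All.lookup c∉ (∈-map⁺ _ (complete (dart-adjacent z~p S vb∈) b≢a))

      treeColour-proper : ∀ {v a b x y} → TreeColour v a x → TreeColour v b y → a ≢ b → x ≢ y
      treeColour-proper (up av∈) (up bv∈) a≢b = contradiction (dart-unique z~p S av∈ bv∈) a≢b
      treeColour-proper (up av∈) (down vb∈) a≢b = up≢down av∈ vb∈ (≢-sym a≢b)
      treeColour-proper (down va∈) (up bv∈) a≢b = ≢-sym (up≢down bv∈ va∈ a≢b)
      -- Either v is z, whose only tree edge goes to p, or v has a parent and both edges occur in
      -- the star below it.
      treeColour-proper {v} (down va∈) (down vb∈) a≢b with dart-parent S va∈ | dart-parent S vb∈
      ... | inj₁ (_ , refl) | inj₁ (_ , refl) = contradiction refl a≢b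
      ... | inj₁ (refl , _) | inj₂ (_ , xz∈ , _) = contradiction xz∈ target-≢
      ... | inj₂ (_ , xz∈ , _) | inj₁ (refl , _) = contradiction xz∈ target-≢
      ... | inj₂ (x , xv∈ , a≢x) | inj₂ (x′ , x′v∈ , b≢x′)
        with refl ← dart-unique z~p S xv∈ x′v∈ | star xv∈
      ...   | xs , _ ∷ xs! , complete = λ eq → a≢b (unique-map-injective (λ x → c (v , x)) xs!
        (complete (dart-adjacent z~p S va∈) a≢x) (complete (dart-adjacent z~p S vb∈) b≢x′) eq)

      -- A relation on ordered pairs of ends, so that symmetry and properness follow by cases on the
      -- kind of edge.
      data HasColour (v w : Fin n) : ℕ → Set where
        treeEdge : ∀ {x} → TreeColour v w x → HasColour v w x
        rimOut   : NextLeaf T′ ρ v w → HasColour v w (rim v)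
        rimIn    : NextLeaf T′ ρ w v → HasColour v w (rim w)

      hasColour-sym : ∀ {v w x} → HasColour v w x → HasColour w v x
      hasColour-sym (treeEdge (down vw∈)) = treeEdge (up vw∈)
      hasColour-sym (treeEdge (up wv∈))   = treeEdge (down wv∈)
      hasColour-sym (rimOut v→w)          = rimIn v→w
      hasColour-sym (rimIn w→v)           = rimOut w→v

      tree≢out : ∀ {v a b x} → TreeColour v a x → NextLeaf T′ ρ v b → x ≢ rim v
      tree≢out tc (v-leaf , _) = RimColours.edge≢out (rimColours _ v-leaf) tc

      nextLeaf-target : ∀ {v w} → NextLeaf T′ ρ v w → Leaf w
      nextLeaf-target (_ , _ , _ , p) = firstLeaf-leaf p

      tree≢in : ∀ {v a b x} → TreeColour v a x → NextLeaf T′ ρ b v → x ≢ rim b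
      tree≢in tc b→v with rimColours _ (nextLeaf-target b→v)
      -- A leaf has only one predecessor, so b is the one recorded at v.
      ... | rc with refl ← nextLeaf-injective b→v (RimColours.nextLeaf rc) = ≢-sym (RimColours.in≢edge rc tc)

      out≢in : ∀ {v a b} → NextLeaf T′ ρ v a → NextLeaf T′ ρ b v → rim v ≢ rim b
      out≢in _ b→v with rimColours _ (nextLeaf-target b→v)
      ... | rc with refl ← nextLeaf-injective b→v (RimColours.nextLeaf rc) = ≢-sym (RimColours.in≢out rc)

      hasColour-proper : ∀ {v a b x y} → HasColour v a x → HasColour v b y → a ≢ b → x ≢ y
      hasColour-proper (treeEdge ta) (treeEdge tb) a≢b = treeColour-proper ta tb a≢b
      hasColour-proper (treeEdge ta) (rimOut v→b)  _   = tree≢out ta v→b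
      hasColour-proper (treeEdge ta) (rimIn b→v)   _   = tree≢in ta b→v
      hasColour-proper (rimOut v→a)  (treeEdge tb) _   = ≢-sym (tree≢out tb v→a)
      hasColour-proper (rimOut v→a)  (rimOut v→b)  a≢b = contradiction (nextLeaf-functional v→a v→b) a≢b
      hasColour-proper (rimOut v→a)  (rimIn b→v)   _   = out≢in v→a b→v
      hasColour-proper (rimIn a→v)   (treeEdge tb) _   = ≢-sym (tree≢in tb a→v)
      hasColour-proper (rimIn a→v)   (rimOut v→b)  _   = ≢-sym (out≢in v→b a→v)
      hasColour-proper (rimIn a→v)   (rimIn b→v)   a≢b = contradiction (nextLeaf-injective a→v b→v) a≢b

      rim∈ : ∀ {v w} → NextLeaf T′ ρ v w → rim v ∈ᵖ palette v w
      rim∈ v→w@(v-leaf , _ , v~q , _) with refl ← nextLeaf-functional v→w (successor-nextLeaf v-leaf v~q) =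
        RimColours.out∈ (rimColours _ v-leaf)

      edgeColour : ∀ e → ∃[ x ] HasColour (Edge.source e) (Edge.target e) x × L e x
      edgeColour (edge s t s<t s~t) with Equivalence.to (adjacency s t) s~t
      ... | inj₁ s~t′ with dart-complete s~t′
      ...   | inj₁ st∈ = _ , treeEdge (down st∈) ,
        subst (λ e → L e _) (mkEdge-edge s~t s~t) (palette⊆L s~t (valid-edge edgePalette rimPalette S valid st∈))
      ...   | inj₂ ts∈ = _ , treeEdge (up ts∈) ,
        subst (λ e → L e _) (mkEdge-edge′ (Graph.sym G s t s~t) s~t)
          (palette⊆L _ (valid-edge edgePalette rimPalette S valid ts∈))
      edgeColour (edge s t s<t s~t) | inj₂ (inj₁ s→t) =
        rim s , rimOut s→t , subst (λ e → L e _) (mkEdge-edge s~t s~t) (palette⊆L s~t (rim∈ s→t))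
      edgeColour (edge s t s<t s~t) | inj₂ (inj₂ t→s) =
        rim t , rimIn t→s , subst (λ e → L e _) (mkEdge-edge′ (Graph.sym G s t s~t) s~t) (palette⊆L _ (rim∈ t→s))

      listColouring : ListEdgeColouring G L
      listColouring = record
        { colour   = λ e → proj₁ (edgeColour e)
        ; fromList = λ e → proj₂ (proj₂ (edgeColour e))
        ; proper   = proper
        }
        where
        proper : ∀ e f → e ≢ f → Graph.ShareEndpoint G e f → proj₁ (edgeColour e) ≢ proj₁ (edgeColour f)
        proper e f e≢f (v , v∈e , v∈f) with edgeColour e | edgeColour f
        proper e f e≢f (v , inj₁ refl , inj₁ refl) | _ , hx , _ | _ , hy , _ =
          hasColour-proper hx hy λ { refl → e≢f (Edges.edge-≡ G) }
        proper e f e≢f (v , inj₁ refl , inj₂ refl) | _ , hx , _ | _ , hy , _ =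
          -- If the other ends agreed too, e and f would order the same two vertices in opposite
          -- ways.
          hasColour-proper hx (hasColour-sym hy) λ { refl → Fin.<-asym (Edge.ordered e) (Edge.ordered f) }
        proper e f e≢f (v , inj₂ refl , inj₁ refl) | _ , hx , _ | _ , hy , _ =
          hasColour-proper (hasColour-sym hx) hy λ { refl → Fin.<-asym (Edge.ordered e) (Edge.ordered f) }
        proper e f e≢f (v , inj₂ refl , inj₂ refl) | _ , hx , _ | _ , hy , _ =
          hasColour-proper (hasColour-sym hx) (hasColour-sym hy) λ { refl → e≢f (Edges.edge-≡ G) }

  listColouring : ListEdgeColouring G L
  listColouring =
    let u , v , u~v , v-inner = connected⇒inner T′ (ℕ.≤-trans (ℕ.n≤1+n 3) fourVertices) (proj₁ isTree)
        open Cherry (cherry noDegreeTwo degree≤k u~v v-inner (build u~v))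
        -- The right leaf becomes the root z, which makes the left leaf the last child of the
        -- centre, as the greedy closing step requires.
        open Rooted inner leftLeaf rightLeaf leftEdge rightEdge different successive (build (adj-sym rightEdge))
        open RootedColouring rooted
        c , d , valid , d-z = decoded colouring
    in Colours.listColouring l∈Z l≢e e≢r l≢r c d valid d-z

theorem3 : (n : ℕ) (G : Graph n) → IsHalin G →
    ListChromaticIndex G (Graph.maxDegree G)
theorem3 n G halin = (λ L large → Halin.listColouring G halin L large) , Edges.choosable⇒maxDegree≤ G
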